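{- Let $\epsilon$ be a positive parameter. Then there is a deterministic algorithm that, given query access to a list $a_1\le a_2\le\cdots\le a_n$ of nonnegative real numbers sorted in nondecreasing order (and given $n$ and $\epsilon$), outputs a $(1+\epsilon)$-approximation for the sum $\sum_{i=1}^n a_i$ in time $$O\!\left(\frac{1}{\epsilon}\min\!\left(\log n,\ \log\frac{x_{max}}{x_{min}}\right)\cdot\left(\log\frac{1}{\epsilon}+\log\log n\right)\right),$$ where $x_{max}$ and $x_{min}$ are the largest and the least positive elements of the input list, respectively.
   Context: A real number $s$ is a $(1+\epsilon)$-approximation for the sum of $a_1,\dots,a_n$ if $\frac{1}{1+\epsilon}\sum_{i=1}^n a_i\le s\le (1+\epsilon)\sum_{i=1}^n a_i$. The algorithm accesses the input list by reading (querying) individual entries $a_i$ at unit cost; running time counts such queries and arithmetic operations.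
   Formalization: The time bound is O((1+max(1,1/ε)·min(log n, log(x_max/x_min)))·(log max(2,1/ε)+log max(2,log n))), since the stated one is 0 or undefined when x_max=x_min or n=1 and fails for large ε; with no positive entry the ratio is taken as 1. -}

module Defs where

open import Level using (0ℓ)
open import Algebra.Bundles using (CommutativeRing)
open import Algebra.Structures using (IsCommutativeRing)
open import Data.Bool.Base using (if_then_else_)
open import Data.Fin.Base as Fin using (Fin; toℕ)
open import Data.Fin.Properties using (toℕ-injective)
open import Data.Nat.Base as ℕ using (ℕ; zero; suc)
open import Data.Nat.Properties using (_≟_)
open import Data.Product using (∃; _×_; _,_)
open import Data.Vec.Functional using (Vector)
open import Relation.Binary.Bundles using (TotalOrder)
open import Relation.Binary.Structures using (IsStrictTotalOrder)
open import Relation.Binary.PropositionalEquality using (_≡_; _≢_; refl; sym; trans)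
open import Relation.Nullary using (¬_; does; contradiction)
import Algebra.Construct.NaturalChoice.Max as Max
import Algebra.Construct.NaturalChoice.Min as Min
import Algebra.Definitions.RawMonoid as RawMonoidDefs
import Relation.Binary.Construct.StrictToNonStrict as ToNonStrict

record OrderedField : Set₁ where
  infix  8 -_
  infix  9 _⁻¹
  infixl 7 _*_ _/_
  infixl 6 _+_ _-_
  infix  4 _<_ _≤_
  field
    ℝ                  : Set
    _+_ _*_            : ℝ → ℝ → ℝ
    -_ _⁻¹             : ℝ → ℝ
    0# 1#              : ℝ
    _<_                : ℝ → ℝ → Set
    isCommutativeRing  : IsCommutativeRing _≡_ _+_ _*_ -_ 0# 1#
    isStrictTotalOrder : IsStrictTotalOrder _≡_ _<_
    0<1                : 0# < 1#
    ⁻¹-inverseʳ        : ∀ x → x ≢ 0# → x * x ⁻¹ ≡ 1#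
    -- As usual, inversion is made total by sending 0 to 0.
    0⁻¹≡0              : 0# ⁻¹ ≡ 0#
    +-monoˡ-<          : ∀ z {x y} → x < y → x + z < y + z
    *-pos              : ∀ {x y} → 0# < x → 0# < y → 0# < x * y

  commutativeRing : CommutativeRing 0ℓ 0ℓ
  commutativeRing = record { isCommutativeRing = isCommutativeRing }

  _≤_ : ℝ → ℝ → Set
  _≤_ = ToNonStrict._≤_ _≡_ _<_

  totalOrder : TotalOrder 0ℓ 0ℓ 0ℓ
  totalOrder = record { isTotalOrder = ToNonStrict.isTotalOrder _≡_ _<_ isStrictTotalOrder }

  open Max totalOrder public using (_⊔_)
  open Min totalOrder public using (_⊓_)

  open RawMonoidDefs (CommutativeRing.+-rawMonoid commutativeRing) public
    using (sum) renaming (_×_ to _·_)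

  fromℕ : ℕ → ℝ
  fromℕ n = n · 1#

  _-_ _/_ : ℝ → ℝ → ℝ
  x - y = x + (- y)
  x / y = x * y ⁻¹

  UpperBound : (ℝ → Set) → ℝ → Set
  UpperBound S u = ∀ x → S x → x ≤ u

-- The classical real numbers, up to isomorphism: a Dedekind-complete ordered
-- field.  The order is trichotomous because comparisons are primitive operations
-- of the machine below; the Archimedean property follows from completeness
-- classically but has to be listed here to be usable constructively.
record RealNumbers : Set₁ where
  field
    orderedField : OrderedField

  open OrderedField orderedField public

  field
    archimedean : ∀ x → ∃ λ n → x < fromℕ n
    supremum    : (S : ℝ → Set) → ∃ S → ∃ (UpperBound S) →
                  ∃ λ s → UpperBound S s × (∀ u → UpperBound S u → s ≤ u)

-- On positive reals these laws determine log₂ uniquely.  Its values elsewhere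
-- are unspecified and never used.
record BinaryLogarithm (𝓡 : RealNumbers) : Set where
  open RealNumbers 𝓡
  field
    log₂        : ℝ → ℝ
    log₂-2      : log₂ (fromℕ 2) ≡ 1#
    log₂-*      : ∀ {x y} → 0# < x → 0# < y → log₂ (x * y) ≡ log₂ x + log₂ y
    log₂-mono-< : ∀ {x y} → 0# < x → x < y → log₂ x < log₂ y

-- Algorithms are programs of a real RAM.  There are two memories, indexed by
-- natural numbers: one of naturals and one of reals.  The input list can only
-- be accessed by query instructions.  There is no rounding of reals to
-- naturals.  Programs contain no real constants, and the syntax does not
-- depend on the input.

infixl 6 _⊕_ _⊖_
infixl 7 _⊗_ _⊘_

data NatExpr : Set where
  lit             : ℕ → NatExpr
  nat             : NatExpr → NatExpr
  _⊕_ _⊖_ _⊗_ _⊘_ : NatExpr → NatExpr → NatExpr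

data RealExpr : Set where
  cast            : NatExpr → RealExpr
  real            : NatExpr → RealExpr
  _⊕_ _⊖_ _⊗_ _⊘_ : RealExpr → RealExpr → RealExpr

data Test : Set where
  nat≺  : NatExpr → NatExpr → Test
  real≺ : RealExpr → RealExpr → Test

infix  5 nat[_]≔_ real[_]≔_ real[_]≔query_
infix  4 if_then_else_fi while_loop_end
infixr 3 _⨾_

data Program : Set where
  skip             : Program
  nat[_]≔_         : NatExpr → NatExpr → Program
  real[_]≔_        : NatExpr → RealExpr → Program
  real[_]≔query_   : NatExpr → NatExpr → Program
  _⨾_              : Program → Program → Program
  if_then_else_fi  : Test → Program → Program → Program
  while_loop_end   : Test → Program → Program

-- The cost of an expression is its number of nodes: each constant, memory
-- access, conversion and arithmetic operation takes unit time.

natCost : NatExpr → ℕ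
natCost (lit _) = 1
natCost (nat e) = suc (natCost e)
natCost (d ⊕ e) = suc (natCost d ℕ.+ natCost e)
natCost (d ⊖ e) = suc (natCost d ℕ.+ natCost e)
natCost (d ⊗ e) = suc (natCost d ℕ.+ natCost e)
natCost (d ⊘ e) = suc (natCost d ℕ.+ natCost e)

realCost : RealExpr → ℕ
realCost (cast e) = suc (natCost e)
realCost (real e) = suc (natCost e)
realCost (d ⊕ e)  = suc (realCost d ℕ.+ realCost e)
realCost (d ⊖ e)  = suc (realCost d ℕ.+ realCost e)
realCost (d ⊗ e)  = suc (realCost d ℕ.+ realCost e)
realCost (d ⊘ e)  = suc (realCost d ℕ.+ realCost e)

testCost : Test → ℕ
testCost (nat≺ d e)  = suc (natCost d ℕ.+ natCost e)
testCost (real≺ d e) = suc (realCost d ℕ.+ realCost e)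

_[_↦_] : {A : Set} → (ℕ → A) → ℕ → A → ℕ → A
(m [ k ↦ v ]) i = if does (i ≟ k) then v else m i

-- Floor division, with value 0 when the divisor is 0.
quotient : ℕ → ℕ → ℕ
quotient m zero    = 0
quotient m (suc k) = m ℕ./ suc k

module Machine (𝓡 : RealNumbers) where
  open RealNumbers 𝓡

  record State : Set where
    constructor ⟨_,_⟩
    field
      nats  : ℕ → ℕ
      reals : ℕ → ℝ

  open State public

  ⟦_⟧ₙ : NatExpr → State → ℕ
  ⟦ lit k ⟧ₙ σ = k
  ⟦ nat e ⟧ₙ σ = nats σ (⟦ e ⟧ₙ σ)
  ⟦ d ⊕ e ⟧ₙ σ = ⟦ d ⟧ₙ σ ℕ.+ ⟦ e ⟧ₙ σ
  ⟦ d ⊖ e ⟧ₙ σ = ⟦ d ⟧ₙ σ ℕ.∸ ⟦ e ⟧ₙ σ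
  ⟦ d ⊗ e ⟧ₙ σ = ⟦ d ⟧ₙ σ ℕ.* ⟦ e ⟧ₙ σ
  ⟦ d ⊘ e ⟧ₙ σ = quotient (⟦ d ⟧ₙ σ) (⟦ e ⟧ₙ σ)

  ⟦_⟧ᵣ : RealExpr → State → ℝ
  ⟦ cast e ⟧ᵣ σ = fromℕ (⟦ e ⟧ₙ σ)
  ⟦ real e ⟧ᵣ σ = reals σ (⟦ e ⟧ₙ σ)
  ⟦ d ⊕ e ⟧ᵣ σ  = ⟦ d ⟧ᵣ σ + ⟦ e ⟧ᵣ σ
  ⟦ d ⊖ e ⟧ᵣ σ  = ⟦ d ⟧ᵣ σ - ⟦ e ⟧ᵣ σ
  ⟦ d ⊗ e ⟧ᵣ σ  = ⟦ d ⟧ᵣ σ * ⟦ e ⟧ᵣ σ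
  ⟦ d ⊘ e ⟧ᵣ σ  = ⟦ d ⟧ᵣ σ / ⟦ e ⟧ᵣ σ

  Holds : Test → State → Set
  Holds (nat≺ d e)  σ = ⟦ d ⟧ₙ σ ℕ.< ⟦ e ⟧ₙ σ
  Holds (real≺ d e) σ = ⟦ d ⟧ᵣ σ < ⟦ e ⟧ᵣ σ

  setNat : ℕ → ℕ → State → State
  setNat k v σ = ⟨ nats σ [ k ↦ v ] , reals σ ⟩

  setReal : ℕ → ℝ → State → State
  setReal k v σ = ⟨ nats σ , reals σ [ k ↦ v ] ⟩

  -- a ⊢ P , σ ⇓ t , σ′ : on the list a, program P started in state σ halts in
  -- state σ′ after t steps.  Entries are numbered from 0, and a query outside
  -- the list has no derivation: the machine is stuck.
  infix 2 _⊢_,_⇓_,_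
  data _⊢_,_⇓_,_ {n} (a : Vector ℝ n) : Program → State → ℕ → State → Set where
    ⇓skip    : ∀ {σ} → a ⊢ skip , σ ⇓ 1 , σ
    ⇓nat     : ∀ {σ d e} →
               a ⊢ nat[ d ]≔ e , σ ⇓ suc (natCost d ℕ.+ natCost e)
                 , setNat (⟦ d ⟧ₙ σ) (⟦ e ⟧ₙ σ) σ
    ⇓real    : ∀ {σ d e} →
               a ⊢ real[ d ]≔ e , σ ⇓ suc (natCost d ℕ.+ realCost e)
                 , setReal (⟦ d ⟧ₙ σ) (⟦ e ⟧ᵣ σ) σ
    ⇓query   : ∀ {σ d e} (i : Fin n) → ⟦ e ⟧ₙ σ ≡ toℕ i →
               a ⊢ real[ d ]≔query e , σ ⇓ suc (natCost d ℕ.+ natCost e)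
                 , setReal (⟦ d ⟧ₙ σ) (a i) σ
    ⇓seq     : ∀ {σ σ′ σ″ P Q s t} →
               a ⊢ P , σ ⇓ s , σ′ → a ⊢ Q , σ′ ⇓ t , σ″ →
               a ⊢ P ⨾ Q , σ ⇓ s ℕ.+ t , σ″
    ⇓then    : ∀ {σ σ′ b P Q t} → Holds b σ → a ⊢ P , σ ⇓ t , σ′ →
               a ⊢ if b then P else Q fi , σ ⇓ testCost b ℕ.+ t , σ′
    ⇓else    : ∀ {σ σ′ b P Q t} → ¬ Holds b σ → a ⊢ Q , σ ⇓ t , σ′ →
               a ⊢ if b then P else Q fi , σ ⇓ testCost b ℕ.+ t , σ′
    ⇓exit    : ∀ {σ b P} → ¬ Holds b σ →
               a ⊢ while b loop P end , σ ⇓ testCost b , σ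
    ⇓iterate : ∀ {σ σ′ σ″ b P s t} → Holds b σ →
               a ⊢ P , σ ⇓ s , σ′ → a ⊢ while b loop P end , σ′ ⇓ t , σ″ →
               a ⊢ while b loop P end , σ ⇓ testCost b ℕ.+ (s ℕ.+ t) , σ″

  ⇓-deterministic : ∀ {n} {a : Vector ℝ n} {P σ s t σ₁ σ₂} →
                    a ⊢ P , σ ⇓ s , σ₁ → a ⊢ P , σ ⇓ t , σ₂ → s ≡ t × σ₁ ≡ σ₂
  ⇓-deterministic ⇓skip ⇓skip = refl , refl
  ⇓-deterministic ⇓nat  ⇓nat  = refl , refl
  ⇓-deterministic ⇓real ⇓real = refl , refl
  ⇓-deterministic (⇓query i p) (⇓query j q) with refl ← toℕ-injective (trans (sym p) q) = refl , refl
  ⇓-deterministic (⇓seq p q) (⇓seq p′ q′)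
    with refl , refl ← ⇓-deterministic p p′ with refl , refl ← ⇓-deterministic q q′ = refl , refl
  ⇓-deterministic (⇓then _ p) (⇓then _ q) with refl , refl ← ⇓-deterministic p q = refl , refl
  ⇓-deterministic (⇓then b _) (⇓else ¬b _) = contradiction b ¬b
  ⇓-deterministic (⇓else ¬b _) (⇓then b _) = contradiction b ¬b
  ⇓-deterministic (⇓else _ p) (⇓else _ q) with refl , refl ← ⇓-deterministic p q = refl , refl
  ⇓-deterministic (⇓exit _) (⇓exit _) = refl , refl
  ⇓-deterministic (⇓exit ¬b) (⇓iterate b _ _) = contradiction b ¬b
  ⇓-deterministic (⇓iterate b _ _) (⇓exit ¬b) = contradiction b ¬b
  ⇓-deterministic (⇓iterate _ p q) (⇓iterate _ p′ q′)
    with refl , refl ← ⇓-deterministic p p′ with refl , refl ← ⇓-deterministic q q′ = refl , refl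

  -- The length n and the parameter ε are given in the cells with address 0.
  initial : ℕ → ℝ → State
  initial n ε = ⟨ (λ _ → 0) [ 0 ↦ n ] , (λ _ → 0#) [ 0 ↦ ε ] ⟩

  output : State → ℝ
  output σ = reals σ 0

module SumApproximation (𝓡 : RealNumbers) (𝓛 : BinaryLogarithm 𝓡) where
  open RealNumbers 𝓡
  open BinaryLogarithm 𝓛

  Nonnegative : ∀ {n} → Vector ℝ n → Set
  Nonnegative a = ∀ i → 0# ≤ a i

  Sorted : ∀ {n} → Vector ℝ n → Set
  Sorted a = ∀ {i j} → i Fin.≤ j → a i ≤ a j

  _IsApproximation[1+_]Of_ : ℝ → ℝ → ℝ → Set
  s IsApproximation[1+ ε ]Of S = (1# / (1# + ε)) * S ≤ s × s ≤ (1# + ε) * S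

  record PositiveElement {n} (a : Vector ℝ n) (x : ℝ) : Set where
    field
      positive : 0# < x
      element  : ∃ λ i → a i ≡ x

  LargestPositive : ∀ {n} → Vector ℝ n → ℝ → Set
  LargestPositive a x = PositiveElement a x × (∀ y → PositiveElement a y → y ≤ x)

  LeastPositive : ∀ {n} → Vector ℝ n → ℝ → Set
  LeastPositive a x = PositiveElement a x × (∀ y → PositiveElement a y → x ≤ y)

  -- Spread a r : r is the ratio x_max / x_min.  If no element is positive, then
  -- x_max and x_min do not exist; the ratio is taken to be 1, which gives the
  -- least possible time bound.
  data Spread {n} (a : Vector ℝ n) : ℝ → Set where
    ratio      : ∀ {xmax xmin} → LargestPositive a xmax → LeastPositive a xmin →
                 Spread a (xmax / xmin)
    noPositive : (∀ x → ¬ PositiveElement a x) → Spread a 1#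

  -- Equal to log₂ x for x ≥ 2, and to 1 otherwise.
  log⁺ : ℝ → ℝ
  log⁺ x = log₂ (fromℕ 2 ⊔ x)

  -- The quantity  1/ε · min(log n, log r) · (log (1/ε) + log log n)  under the
  -- O-sign, with the usual safeguards where a factor degenerates: the first
  -- product is 0 if n = 1 or r = 1, the logarithms in the second factor may
  -- vanish or be negative or undefined, and 1/ε tends to 0 as ε grows.  If
  -- ε ≤ 1/2, n ≥ 4 and 1/ε · min(log n, log r) ≥ 1, then the two quantities
  -- differ by a factor of at most 2.
  timeBound : ℕ → ℝ → ℝ → ℝ
  timeBound n ε r =
    (1# + (1# ⊔ 1# / ε) * (log₂ (fromℕ n) ⊓ log₂ r)) *
    (log⁺ (1# / ε) + log⁺ (log₂ (fromℕ n)))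

module Submission where

-- Write d₀ ≥ d₁ ≥ … for the list in decreasing order, let m be the least power of
-- two with (m − 1) ε ≥ 2, and let the algorithm jump from rank 0 to rank n.  A jump
-- from rank c to rank c′ adds (c′ − c) d_c to the estimate.  Unless c′ = n, the jump
-- has as its length a multiple of b = ⌊c/m⌋ + 1, and d_c′ is smaller than d_c by the
-- factor 1 + 1/m, while all but c′/m of the elements jumped over are within this
-- factor of d_c.  These exceptions are charged by Abel summation: Σ c′ (d_c − d_c′)
-- telescopes to the estimate itself, so the total relative error is O(1/m).
--
-- Both c (because of b) and 1/d_c grow by the factor 1 + 1/m in each jump, so there
-- are O(m min (log n, log (xmax/xmin))) jumps.  The length of a jump is found with
-- O(log log n + log m) queries: square a trial length until it is too large, find
-- the leading bit by determining the bits of its exponent, then log m further bits.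

open import Defs
open import Algebra.Bundles using (CommutativeRing)
open import Data.Bool.Base using (T)
open import Data.Fin.Base as Fin using (Fin; toℕ; fromℕ<; opposite)
open import Data.Fin.Permutation using (reverse)
open import Data.Nat using (ℕ) renaming (_≤_ to _≤ℕ_)
open import Data.Nat.Base as ℕ using (zero; suc)
open import Data.Product using (∃; _×_; _,_; proj₁; proj₂)
open import Data.Sum.Base using (_⊎_; inj₁; inj₂; [_,_]′)
open import Data.Vec.Functional using (Vector)
open import Function.Base using (_∘_)
open import Relation.Binary.Bundles using (StrictTotalOrder; TotalOrder)
open import Relation.Binary.Definitions using (tri<; tri≈; tri>)
open import Relation.Binary.PropositionalEquality
  using (_≡_; _≢_; refl; sym; trans; cong; cong₂; subst; subst₂)
open import Relation.Nullary using (¬_; contradiction; Dec; yes; no)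
open import Relation.Nullary.Decidable using (¬?; dec-true; dec-false)
import Algebra.Construct.NaturalChoice.Max as Max
import Algebra.Construct.NaturalChoice.Min as Min
import Algebra.Properties.CommutativeMonoid.Sum as Sum
import Algebra.Properties.Semiring.Mult as Mult
import Algebra.Solver.Ring.NaturalCoefficients.Default as SemiringSolver
import Data.Fin.Properties as Fin
import Data.Nat.DivMod as ℕ
import Data.Nat.Properties as ℕ
import Data.Nat.Tactic.RingSolver as ℕ-Solver
import Relation.Binary.Reasoning.StrictPartialOrder as StrictReasoning

-- Arithmetic and order in an ordered field.

module OrderedFieldProperties (𝔽 : OrderedField) where
  open OrderedField 𝔽

  strictTotalOrder : StrictTotalOrder _ _ _
  strictTotalOrder = record { isStrictTotalOrder = isStrictTotalOrder }

  open CommutativeRing commutativeRing public using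
    (+-comm; +-assoc; +-identityˡ; +-identityʳ; *-comm; *-assoc; *-identityˡ; *-identityʳ;
     distribˡ; distribʳ; zeroˡ; zeroʳ; -‿inverseʳ; -‿inverseˡ)
  open TotalOrder totalOrder public using ()
    renaming (refl to ≤-refl; reflexive to ≤-reflexive; trans to ≤-trans)
  open StrictTotalOrder strictTotalOrder public using (compare; _<?_; strictPartialOrder)
    renaming (trans to <-trans; irrefl to <-irrefl)
  module ≤-Reasoning = StrictReasoning strictPartialOrder
  module Solver = SemiringSolver (CommutativeRing.commutativeSemiring commutativeRing)

  open Mult (CommutativeRing.semiring commutativeRing) using (×-homo-+; ×1-homo-*)

  <⇒≤ : ∀ {x y} → x < y → x ≤ y
  <⇒≤ = inj₁

  <-≤-trans : ∀ {x y z} → x < y → y ≤ z → x < z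
  <-≤-trans x<y (inj₁ y<z)  = <-trans x<y y<z
  <-≤-trans x<y (inj₂ refl) = x<y

  ≤-<-trans : ∀ {x y z} → x ≤ y → y < z → x < z
  ≤-<-trans (inj₁ x<y)  y<z = <-trans x<y y<z
  ≤-<-trans (inj₂ refl) y<z = y<z

  ≮⇒≥ : ∀ {x y} → ¬ x < y → y ≤ x
  ≮⇒≥ {x} {y} x≮y with compare x y
  ... | tri< x<y _ _ = contradiction x<y x≮y
  ... | tri≈ _ x≡y _ = inj₂ (sym x≡y)
  ... | tri> _ _ y<x = inj₁ y<x

  ≰⇒> : ∀ {x y} → ¬ x ≤ y → y < x
  ≰⇒> {x} {y} x≰y with compare x y
  ... | tri< x<y _ _ = contradiction (inj₁ x<y) x≰y
  ... | tri≈ _ x≡y _ = contradiction (inj₂ x≡y) x≰y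
  ... | tri> _ _ y<x = y<x

  <⇒≱ : ∀ {x y} → x < y → ¬ y ≤ x
  <⇒≱ x<y y≤x = <-irrefl refl (<-≤-trans x<y y≤x)

  +-monoˡ-≤ : ∀ z {x y} → x ≤ y → x + z ≤ y + z
  +-monoˡ-≤ z (inj₁ x<y)  = inj₁ (+-monoˡ-< z x<y)
  +-monoˡ-≤ z (inj₂ refl) = ≤-refl

  +-monoʳ-≤ : ∀ z {x y} → x ≤ y → z + x ≤ z + y
  +-monoʳ-≤ z {x} {y} x≤y = subst₂ _≤_ (+-comm x z) (+-comm y z) (+-monoˡ-≤ z x≤y)

  +-mono-≤ : ∀ {w x y z} → w ≤ x → y ≤ z → w + y ≤ x + z
  +-mono-≤ {x = x} {y} w≤x y≤z = ≤-trans (+-monoˡ-≤ y w≤x) (+-monoʳ-≤ x y≤z)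

  x+z-z≡x : ∀ x z → x + z + - z ≡ x
  x+z-z≡x x z = trans (+-assoc x z (- z)) (trans (cong (x +_) (-‿inverseʳ z)) (+-identityʳ x))

  x-z+z≡x : ∀ x z → x + - z + z ≡ x
  x-z+z≡x x z = trans (+-assoc x (- z) z) (trans (cong (x +_) (-‿inverseˡ z)) (+-identityʳ x))

  +-cancelʳ-≤ : ∀ z {x y} → x + z ≤ y + z → x ≤ y
  +-cancelʳ-≤ z {x} {y} p = subst₂ _≤_ (x+z-z≡x x z) (x+z-z≡x y z) (+-monoˡ-≤ (- z) p)

  -- To derive x ≤ y from w ≤ z, it suffices that y − x = z − w.
  transfer-≤ : ∀ {w z x y} → w ≤ z → x + z ≡ y + w → x ≤ y
  transfer-≤ {w} {z} {x} {y} w≤z eq =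
    +-cancelʳ-≤ z (subst (_≤ y + z) (sym eq) (+-monoʳ-≤ y w≤z))

  x≤y⇒∃ : ∀ {x y} → x ≤ y → ∃ λ z → 0# ≤ z × y ≡ x + z
  x≤y⇒∃ {x} {y} x≤y = y + - x
    , subst (_≤ y + - x) (-‿inverseʳ x) (+-monoˡ-≤ (- x) x≤y)
    , sym (trans (+-comm x _) (x-z+z≡x y x))

  +-pres-0≤ : ∀ {x y} → 0# ≤ x → 0# ≤ y → 0# ≤ x + y
  +-pres-0≤ {x} {y} 0≤x 0≤y = subst (_≤ x + y) (+-identityˡ 0#) (+-mono-≤ 0≤x 0≤y)

  *-pres-0≤ : ∀ {x y} → 0# ≤ x → 0# ≤ y → 0# ≤ x * y
  *-pres-0≤ (inj₁ 0<x) (inj₁ 0<y) = inj₁ (*-pos 0<x 0<y)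
  *-pres-0≤ {x} (inj₁ _) (inj₂ refl) = inj₂ (sym (zeroʳ x))
  *-pres-0≤ {y = y} (inj₂ refl) _ = inj₂ (sym (zeroˡ y))

  *-monoʳ-≤ : ∀ {z x y} → 0# ≤ z → x ≤ y → z * x ≤ z * y
  *-monoʳ-≤ {z} {x} 0≤z x≤y with d , 0≤d , refl ← x≤y⇒∃ x≤y =
    subst₂ _≤_ (+-identityʳ _) (sym (distribˡ z x d)) (+-monoʳ-≤ (z * x) (*-pres-0≤ 0≤z 0≤d))

  *-monoˡ-≤ : ∀ {z x y} → 0# ≤ z → x ≤ y → x * z ≤ y * z
  *-monoˡ-≤ {z} {x} {y} 0≤z x≤y = subst₂ _≤_ (*-comm z x) (*-comm z y) (*-monoʳ-≤ 0≤z x≤y)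

  *-mono-≤ : ∀ {w x y z} → 0# ≤ y → 0# ≤ x → w ≤ x → y ≤ z → w * y ≤ x * z
  *-mono-≤ 0≤y 0≤x w≤x y≤z = ≤-trans (*-monoˡ-≤ 0≤y w≤x) (*-monoʳ-≤ 0≤x y≤z)

  *-monoʳ-< : ∀ {z x y} → 0# < z → x < y → z * x < z * y
  *-monoʳ-< {z} {x} {y} 0<z x<y with d , 0≤d , refl ← x≤y⇒∃ (<⇒≤ x<y) | 0≤d
  ... | inj₁ 0<d = subst₂ _<_ (+-identityˡ _)
                     (trans (+-comm (z * d) (z * x)) (sym (distribˡ z x d)))
                     (+-monoˡ-< (z * x) (*-pos 0<z 0<d))
  ... | inj₂ refl = contradiction x<y (<-irrefl (sym (+-identityʳ x)))

  *-cancelˡ-≤ : ∀ {z x y} → 0# < z → z * x ≤ z * y → x ≤ y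
  *-cancelˡ-≤ 0<z zx≤zy = ≮⇒≥ λ y<x → <⇒≱ (*-monoʳ-< 0<z y<x) zx≤zy

  *-cancelˡ-< : ∀ {z x y} → 0# ≤ z → z * x < z * y → x < y
  *-cancelˡ-< {z} {x} {y} 0≤z zx<zy with compare x y
  ... | tri< x<y _ _  = x<y
  ... | tri≈ _ refl _ = contradiction zx<zy (<-irrefl refl)
  ... | tri> _ _ y<x  = contradiction (*-monoʳ-≤ 0≤z (<⇒≤ y<x)) (<⇒≱ zx<zy)

  *-inverseʳ : ∀ {x} → 0# < x → x * x ⁻¹ ≡ 1#
  *-inverseʳ {x} 0<x = ⁻¹-inverseʳ x λ x≡0 → <-irrefl (sym x≡0) 0<x

  ⁻¹-pos : ∀ {x} → 0# < x → 0# < x ⁻¹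
  ⁻¹-pos {x} 0<x =
    *-cancelˡ-< (<⇒≤ 0<x) (subst₂ _<_ (sym (zeroʳ x)) (sym (*-inverseʳ 0<x)) 0<1)

  x*[y/x]≡y : ∀ {x} y → 0# < x → x * (y / x) ≡ y
  x*[y/x]≡y {x} y 0<x =
    trans (cong (x *_) (*-comm y (x ⁻¹)))
      (trans (sym (*-assoc x (x ⁻¹) y)) (trans (cong (_* y) (*-inverseʳ 0<x)) (*-identityˡ y)))

  0≤1 : 0# ≤ 1#
  0≤1 = <⇒≤ 0<1

  fromℕ-+ : ∀ m n → fromℕ (m ℕ.+ n) ≡ fromℕ m + fromℕ n
  fromℕ-+ = ×-homo-+ 1#

  fromℕ-* : ∀ m n → fromℕ (m ℕ.* n) ≡ fromℕ m * fromℕ n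
  fromℕ-* = ×1-homo-*

  fromℕ-1 : fromℕ 1 ≡ 1#
  fromℕ-1 = +-identityʳ 1#

  0≤fromℕ : ∀ n → 0# ≤ fromℕ n
  0≤fromℕ zero    = ≤-refl
  0≤fromℕ (suc n) = +-pres-0≤ 0≤1 (0≤fromℕ n)

  fromℕ-mono-≤ : ∀ {m n} → m ℕ.≤ n → fromℕ m ≤ fromℕ n
  fromℕ-mono-≤ (ℕ.z≤n {n}) = 0≤fromℕ n
  fromℕ-mono-≤ (ℕ.s≤s m≤n)   = +-monoʳ-≤ 1# (fromℕ-mono-≤ m≤n)

  0<fromℕ : ∀ {n} → 0 ℕ.< n → 0# < fromℕ n
  0<fromℕ 0<n = <-≤-trans (subst (0# <_) (sym fromℕ-1) 0<1) (fromℕ-mono-≤ 0<n)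

-- Chains of jumps along a decreasing sequence: their error and their number.

module Jumps (𝔽 : OrderedField) where
  open OrderedField 𝔽
  open OrderedFieldProperties 𝔽

  sumFrom : (ℕ → ℝ) → ℕ → ℕ → ℝ
  sumFrom v c zero    = 0#
  sumFrom v c (suc l) = v c + sumFrom v (suc c) l

  sumFrom-++ : ∀ v c k l → sumFrom v c (k ℕ.+ l) ≡ sumFrom v c k + sumFrom v (c ℕ.+ k) l
  sumFrom-++ v c zero    l = trans (cong (λ i → sumFrom v i l) (sym (ℕ.+-identityʳ c)))
                                   (sym (+-identityˡ _))
  sumFrom-++ v c (suc k) l =
    trans (cong (v c +_) (sumFrom-++ v (suc c) k l))
      (trans (sym (+-assoc (v c) _ _))
        (cong (λ i → sumFrom v c (suc k) + sumFrom v i l) (sym (ℕ.+-suc c k))))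

  sumFrom-≤ : ∀ v c l {x} → (∀ i → i ℕ.< l → v (c ℕ.+ i) ≤ x) → sumFrom v c l ≤ fromℕ l * x
  sumFrom-≤ v c zero    {x} _ = ≤-reflexive (sym (zeroˡ x))
  sumFrom-≤ v c (suc l) {x} h =
    subst (sumFrom v c (suc l) ≤_)
      (trans (cong (_+ fromℕ l * x) (sym (*-identityˡ x))) (sym (distribʳ x 1# (fromℕ l))))
      (+-mono-≤ (subst (λ i → v i ≤ x) (ℕ.+-identityʳ c) (h 0 (ℕ.s≤s ℕ.z≤n)))
                (sumFrom-≤ v (suc c) l λ i i<l →
                  subst (λ j → v j ≤ x) (ℕ.+-suc c i) (h (suc i) (ℕ.s≤s i<l))))

  sumFrom-≥ : ∀ v c l {x z} → (∀ i → i ℕ.< l → x ≤ z * v (c ℕ.+ i)) →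
              fromℕ l * x ≤ z * sumFrom v c l
  sumFrom-≥ v c zero    {x} {z} _ = ≤-reflexive (trans (zeroˡ x) (sym (zeroʳ z)))
  sumFrom-≥ v c (suc l) {x} {z} h =
    subst₂ _≤_
      (trans (cong (_+ fromℕ l * x) (sym (*-identityˡ x))) (sym (distribʳ x 1# (fromℕ l))))
      (sym (distribˡ z (v c) _))
      (+-mono-≤ (subst (λ i → x ≤ z * v i) (ℕ.+-identityʳ c) (h 0 (ℕ.s≤s ℕ.z≤n)))
                (sumFrom-≥ v (suc c) l λ i i<l →
                  subst (λ j → x ≤ z * v j) (ℕ.+-suc c i) (h (suc i) (ℕ.s≤s i<l))))

  -- Jumps m v c l K T : in K jumps one gets from rank c to rank c + l of the
  -- decreasing sequence v, and T adds up, for each jump, its length times the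
  -- value at its start.  The first 1 + y elements that a jump passes are within
  -- the factor 1 + 1/m of the value at its start; nothing is known of the other u.
  data Jumps (m : ℕ) (v : ℕ → ℝ) : (c l K : ℕ) → ℝ → Set where
    done : ∀ {c} → Jumps m v c 0 0 0#
    jump : ∀ {c l K T} y u →
           (∀ i → i ℕ.≤ y → fromℕ m * v c ≤ fromℕ (suc m) * v (c ℕ.+ i)) →
           m ℕ.* u ℕ.≤ c ℕ.+ suc y →
           (0 ℕ.< l → fromℕ (suc m) * v (c ℕ.+ (suc y ℕ.+ u)) < fromℕ m * v c) →
           (0 ℕ.< l → suc m ℕ.* c ℕ.≤ m ℕ.* (c ℕ.+ (suc y ℕ.+ u))) →
           Jumps m v (c ℕ.+ (suc y ℕ.+ u)) l K T →
           Jumps m v c (suc y ℕ.+ u ℕ.+ l) (suc K) (fromℕ (suc y ℕ.+ u) * v c + T)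

  -- The induction step of `jumps≤sum` in letters: `S₁`, `S₂`, `S₃` are the sums over the known, the
  -- unknown and the remaining elements. Write `V` as `V′ + d`, multiply the hypothesis on `μ * U`
  -- by the drop `d`, and add everything up; what is left is a semiring identity.
  jump-error : ∀ {μ Y U C T S₁ S₂ S₃ V V′} → V′ ≤ V →
    μ * T ≤ (1# + μ) * S₃ + (C + (Y + U)) * V′ + T →
    Y * (μ * V) ≤ (1# + μ) * S₁ →
    (1# + μ) * (U * V′) ≤ (1# + μ) * S₂ →
    μ * U ≤ C + Y →
    0# ≤ U * V →
    μ * ((Y + U) * V + T) ≤ (1# + μ) * (S₁ + S₂ + S₃) + C * V + ((Y + U) * V + T)
  jump-error {μ} {Y} {U} {C} {T} {S₁} {S₂} {S₃} {V′ = V′} V′≤V rest known unknown few positive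
    with d , 0≤d , refl ← x≤y⇒∃ V′≤V =
    transfer-≤ (+-mono-≤ (+-mono-≤ (+-mono-≤ rest known) unknown)
                         (+-mono-≤ (*-monoˡ-≤ 0≤d few) positive))
      (solve 10 (λ μ Y U C T S₁ S₂ S₃ V′ d →
          μ :* ((Y :+ U) :* (V′ :+ d) :+ T)
            :+ ((con 1 :+ μ) :* S₃ :+ (C :+ (Y :+ U)) :* V′ :+ T :+ (con 1 :+ μ) :* S₁
                :+ (con 1 :+ μ) :* S₂ :+ ((C :+ Y) :* d :+ U :* (V′ :+ d)))
        := (con 1 :+ μ) :* (S₁ :+ S₂ :+ S₃) :+ C :* (V′ :+ d) :+ ((Y :+ U) :* (V′ :+ d) :+ T)
            :+ (μ :* T :+ Y :* (μ :* (V′ :+ d)) :+ (con 1 :+ μ) :* (U :* V′)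
                :+ (μ :* U :* d :+ con 0)))
        refl μ Y U C T S₁ S₂ S₃ V′ d)
    where open Solver

  module _ {m : ℕ} {v : ℕ → ℝ} (antitone : ∀ {i j} → i ℕ.≤ j → v j ≤ v i)
           (nonneg : ∀ i → 0# ≤ v i) where

    -- No element exceeds the value at the start of the jump that passes it.
    sum≤jumps : ∀ {c l K T} → Jumps m v c l K T → sumFrom v c l ≤ T
    sum≤jumps done = ≤-refl
    sum≤jumps {c} (jump {l = l} {T = T} y u _ _ _ _ js) =
      subst (_≤ fromℕ (suc y ℕ.+ u) * v c + T) (sym (sumFrom-++ v c (suc y ℕ.+ u) l))
        (+-mono-≤ (sumFrom-≤ v c (suc y ℕ.+ u) λ i _ → antitone (ℕ.m≤m+n c i)) (sum≤jumps js))

    -- The error of a jump to rank c′ is at most u (v c − v c′) up to the factor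
    -- 1 + 1/m on the known elements.  Since m u ≤ c′, Abel summation bounds the
    -- sum of these errors by T / m; the term c (v c) is the boundary term.
    jumps≤sum : ∀ {c l K T} → Jumps m v c l K T →
                fromℕ m * T ≤ fromℕ (suc m) * sumFrom v c l + fromℕ c * v c + T
    jumps≤sum {c} done =
      subst₂ _≤_ (sym (zeroʳ (fromℕ m)))
        (sym (trans (+-identityʳ _)
          (trans (cong (_+ fromℕ c * v c) (zeroʳ (fromℕ (suc m)))) (+-identityˡ _))))
        (*-pres-0≤ (0≤fromℕ c) (nonneg c))
    jumps≤sum {c} (jump {l = l} {T = T} y u near few _ _ js) =
      subst₂ (λ z S → fromℕ m * (z * v c + T) ≤ fromℕ (suc m) * S + fromℕ c * v c + (z * v c + T))
        (sym (fromℕ-+ (suc y) u))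
        (sym (trans (sumFrom-++ v c (suc y ℕ.+ u) l)
                    (cong (_+ sumFrom v c′ l) (sumFrom-++ v c (suc y) u))))
        (jump-error (antitone (ℕ.m≤m+n c (suc y ℕ.+ u)))
          (subst (λ z → fromℕ m * T ≤ fromℕ (suc m) * sumFrom v c′ l + z * v c′ + T)
             (trans (fromℕ-+ c (suc y ℕ.+ u)) (cong (fromℕ c +_) (fromℕ-+ (suc y) u)))
             (jumps≤sum js))
          (sumFrom-≥ v c (suc y) λ i i<1+y → near i (ℕ.≤-pred i<1+y))
          (*-monoʳ-≤ (0≤fromℕ (suc m))
            (subst (fromℕ u * v c′ ≤_) (*-identityˡ _) (sumFrom-≥ v (c ℕ.+ suc y) u λ i i<u →
              subst (v c′ ≤_) (sym (*-identityˡ _)) (antitone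
                (subst (c ℕ.+ suc y ℕ.+ i ℕ.≤_) (ℕ.+-assoc c (suc y) u)
                  (ℕ.+-monoʳ-≤ (c ℕ.+ suc y) (ℕ.<⇒≤ i<u)))))))
          (subst₂ _≤_ (fromℕ-* m u) (fromℕ-+ c (suc y)) (fromℕ-mono-≤ few))
          (*-pres-0≤ (0≤fromℕ u) (nonneg c)))
      where c′ = c ℕ.+ (suc y ℕ.+ u)

    -- Every jump but the last multiplies the rank by at least 1 + 1/m; the last one may be cut
    -- short by the end of the list, so it gives no factor.
    jumps-rank : ∀ {c l k T} → Jumps m v c l (suc k) T →
                 suc m ℕ.^ k ℕ.* c ℕ.≤ m ℕ.^ k ℕ.* (c ℕ.+ l)
    jumps-rank {c} (jump {l = zero} y u _ _ _ _ done) =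
      ℕ.+-monoˡ-≤ 0 (ℕ.m≤m+n c _)
    jumps-rank {c} {k = suc k} (jump {l = l} y u _ _ _ grow js@(jump _ _ _ _ _ _ _)) = begin
      suc m ℕ.* suc m ℕ.^ k ℕ.* c          ≡⟨ ℕ.*-assoc (suc m) (suc m ℕ.^ k) c ⟩
      suc m ℕ.* (suc m ℕ.^ k ℕ.* c)        ≡⟨ swap (suc m) (suc m ℕ.^ k) c ⟩
      suc m ℕ.^ k ℕ.* (suc m ℕ.* c)        ≤⟨ ℕ.*-monoʳ-≤ (suc m ℕ.^ k) (grow (ℕ.s≤s ℕ.z≤n)) ⟩
      suc m ℕ.^ k ℕ.* (m ℕ.* c′)           ≡⟨ swap m (suc m ℕ.^ k) c′ ⟨
      m ℕ.* (suc m ℕ.^ k ℕ.* c′)           ≤⟨ ℕ.*-monoʳ-≤ m (jumps-rank js) ⟩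
      m ℕ.* (m ℕ.^ k ℕ.* (c′ ℕ.+ l))       ≡⟨ ℕ.*-assoc m _ _ ⟨
      m ℕ.* m ℕ.^ k ℕ.* (c′ ℕ.+ l)         ≡⟨ cong (m ℕ.* m ℕ.^ k ℕ.*_) (ℕ.+-assoc c (suc y ℕ.+ u) l) ⟩
      m ℕ.* m ℕ.^ k ℕ.* (c ℕ.+ (suc y ℕ.+ u ℕ.+ l)) ∎
      where
      open ℕ.≤-Reasoning
      c′ = c ℕ.+ (suc y ℕ.+ u)
      swap : ∀ a b d → a ℕ.* (b ℕ.* d) ≡ b ℕ.* (a ℕ.* d)
      swap a b d = trans (sym (ℕ.*-assoc a b d))
                     (trans (cong (ℕ._* d) (ℕ.*-comm a b)) (ℕ.*-assoc b a d))

    -- Two jumps do not count: the last one, and the first one, since growth by a factor says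
    -- nothing at rank 0. After the first jump the rank is at least 1.
    #jumps≤rank : ∀ {n K T} → 1 ℕ.≤ n → Jumps m v 0 n K T →
                  suc m ℕ.^ (K ℕ.∸ 2) ℕ.≤ m ℕ.^ (K ℕ.∸ 2) ℕ.* n
    #jumps≤rank {K = zero} () done
    #jumps≤rank {n} {K = suc zero} 1≤n _ = subst (1 ℕ.≤_) (sym (ℕ.+-identityʳ n)) 1≤n
    #jumps≤rank {K = suc (suc k)} _ (jump {l = l} y u _ _ _ _ js) =
      ℕ.≤-trans (ℕ.m≤m*n (suc m ℕ.^ k) (suc y ℕ.+ u)) (jumps-rank js)

    -- The witness is the start of the last jump but one. Its value is positive because that jump
    -- leads to a strictly smaller multiple of a nonnegative value.
    jumps-value : ∀ {c l k T} → Jumps m v c l (2 ℕ.+ k) T →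
                  ∃ λ z → 0# < v z × fromℕ (suc m ℕ.^ k) * v z ≤ fromℕ (m ℕ.^ k) * v c
    jumps-value {c} {k = zero} (jump y u _ _ fall _ (jump _ _ _ _ _ _ _)) =
      c , *-cancelˡ-< (0≤fromℕ m)
            (subst (_< fromℕ m * v c) (sym (zeroʳ (fromℕ m)))
              (≤-<-trans (*-pres-0≤ (0≤fromℕ (suc m)) (nonneg _)) (fall (ℕ.s≤s ℕ.z≤n))))
        , ≤-refl
    jumps-value {c} {k = suc k} (jump y u _ _ fall _ js@(jump _ _ _ _ _ _ _))
      with z , 0<vz , le ← jumps-value js = z , 0<vz , (begin
      fromℕ (suc m ℕ.* suc m ℕ.^ k) * v z            ≡⟨ cong (_* v z) (fromℕ-* (suc m) (suc m ℕ.^ k)) ⟩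
      fromℕ (suc m) * fromℕ (suc m ℕ.^ k) * v z      ≡⟨ *-assoc _ _ _ ⟩
      fromℕ (suc m) * (fromℕ (suc m ℕ.^ k) * v z)    ≤⟨ *-monoʳ-≤ (0≤fromℕ (suc m)) le ⟩
      fromℕ (suc m) * (fromℕ (m ℕ.^ k) * v c′)       ≡⟨ swap _ _ _ ⟩
      fromℕ (m ℕ.^ k) * (fromℕ (suc m) * v c′)       ≤⟨ *-monoʳ-≤ (0≤fromℕ (m ℕ.^ k)) (<⇒≤ (fall (ℕ.s≤s ℕ.z≤n))) ⟩
      fromℕ (m ℕ.^ k) * (fromℕ m * v c)              ≡⟨ swap _ _ _ ⟩
      fromℕ m * (fromℕ (m ℕ.^ k) * v c)              ≡⟨ *-assoc _ _ _ ⟨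
      fromℕ m * fromℕ (m ℕ.^ k) * v c                ≡⟨ cong (_* v c) (fromℕ-* m _) ⟨
      fromℕ (m ℕ.* m ℕ.^ k) * v c                    ∎)
      where
      open ≤-Reasoning
      c′ = c ℕ.+ (suc y ℕ.+ u)
      swap : ∀ a b d → a * (b * d) ≡ b * (a * d)
      swap = solve 3 (λ a b d → a :* (b :* d) := b :* (a :* d)) refl
        where open Solver

-- Least witnesses and powers of natural numbers.

least : (Q : ℕ → Set) → (∀ i → Dec (Q i)) → ∃ Q → ∃ λ k → Q k × (∀ i → i ℕ.< k → ¬ Q i)
least Q Q? (k , q) = search k 0 (λ _ ()) (subst Q (sym (ℕ.+-identityʳ k)) q)
  where
  search : ∀ f i → (∀ j → j ℕ.< i → ¬ Q j) → Q (f ℕ.+ i) →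
           ∃ λ k → Q k × (∀ i → i ℕ.< k → ¬ Q i)
  search zero    i below q = i , q , below
  search (suc f) i below q with Q? i
  ... | yes p = i , p , below
  ... | no ¬p = search f (suc i)
    (λ j j<1+i → [ below j , (λ { refl → ¬p }) ]′ (ℕ.m≤n⇒m<n∨m≡n (ℕ.≤-pred j<1+i)))
    (subst Q (sym (ℕ.+-suc f i)) q)

n<2^n : ∀ n → n ℕ.< 2 ℕ.^ n
n<2^n zero    = ℕ.s≤s ℕ.z≤n
n<2^n (suc n) = ℕ.+-mono-≤-< (ℕ.m^n>0 2 n) (ℕ.<-≤-trans (n<2^n n) (ℕ.m≤m+n _ 0))

-- Bernoulli's inequality 1 + k/m ≤ (1 + 1/m)^k without denominators.
bernoulli : ∀ m k → m ℕ.^ k ℕ.* (m ℕ.+ k) ℕ.≤ m ℕ.* suc m ℕ.^ k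
bernoulli m zero = ℕ.≤-reflexive (lemma m)
  where
  lemma : ∀ m → 1 ℕ.* (m ℕ.+ 0) ≡ m ℕ.* 1
  lemma = ℕ-Solver.solve-∀
bernoulli m (suc k) = begin
  m ℕ.* m ℕ.^ k ℕ.* (m ℕ.+ suc k)               ≤⟨ ℕ.m≤m+n _ _ ⟩
  m ℕ.* m ℕ.^ k ℕ.* (m ℕ.+ suc k) ℕ.+ m ℕ.^ k ℕ.* k ≡⟨ lemma₁ m (m ℕ.^ k) k ⟩
  suc m ℕ.* (m ℕ.^ k ℕ.* (m ℕ.+ k))             ≤⟨ ℕ.*-monoʳ-≤ (suc m) (bernoulli m k) ⟩
  suc m ℕ.* (m ℕ.* suc m ℕ.^ k)                 ≡⟨ lemma₂ m (suc m ℕ.^ k) ⟩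
  m ℕ.* (suc m ℕ.* suc m ℕ.^ k)                 ∎
  where
  open ℕ.≤-Reasoning
  lemma₁ : ∀ m p k → m ℕ.* p ℕ.* (m ℕ.+ suc k) ℕ.+ p ℕ.* k ≡ suc m ℕ.* (p ℕ.* (m ℕ.+ k))
  lemma₁ = ℕ-Solver.solve-∀
  lemma₂ : ∀ m p → suc m ℕ.* (m ℕ.* p) ≡ m ℕ.* (suc m ℕ.* p)
  lemma₂ = ℕ-Solver.solve-∀

2*m^m≤[1+m]^m : ∀ m → .{{ℕ.NonZero m}} → 2 ℕ.* m ℕ.^ m ℕ.≤ suc m ℕ.^ m
2*m^m≤[1+m]^m m = ℕ.*-cancelˡ-≤ m
  (ℕ.≤-trans (ℕ.≤-reflexive (lemma m (m ℕ.^ m))) (bernoulli m m))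
  where
  lemma : ∀ m p → m ℕ.* (2 ℕ.* p) ≡ p ℕ.* (m ℕ.+ m)
  lemma = ℕ-Solver.solve-∀

-- Logarithmic estimates for the error and the running time.

module Bounds (𝓡 : RealNumbers) (𝓛 : BinaryLogarithm 𝓡) where
  open RealNumbers 𝓡
  open BinaryLogarithm 𝓛
  open OrderedFieldProperties orderedField
  open SumApproximation 𝓡 𝓛
  open Max totalOrder using (x≤x⊔y; x≤y⊔x)
  open Min totalOrder using (⊓-sel)
  open Solver using (solve; _:=_; _:+_; _:*_; con)

  log₂-mono-≤ : ∀ {x y} → 0# < x → x ≤ y → log₂ x ≤ log₂ y
  log₂-mono-≤ 0<x (inj₁ x<y)  = inj₁ (log₂-mono-< 0<x x<y)
  log₂-mono-≤ 0<x (inj₂ refl) = ≤-refl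

  log₂-1 : log₂ (fromℕ 1) ≡ 0#
  log₂-1 = trans (sym (x+z-z≡x x x))
             (trans (cong (_+ - x)
               (trans (sym (log₂-* 0<1′ 0<1′)) (cong log₂ (sym (fromℕ-* 1 1)))))
               (-‿inverseʳ x))
    where
    x = log₂ (fromℕ 1)
    0<1′ : 0# < fromℕ 1
    0<1′ = 0<fromℕ {1} (ℕ.s≤s ℕ.z≤n)

  log₂-^ : ∀ b k → .{{ℕ.NonZero b}} → log₂ (fromℕ (b ℕ.^ k)) ≡ fromℕ k * log₂ (fromℕ b)
  log₂-^ b zero    = trans log₂-1 (sym (zeroˡ _))
  log₂-^ b (suc k) =
    trans (cong log₂ (fromℕ-* b (b ℕ.^ k)))
      (trans (log₂-* (0<fromℕ (ℕ.>-nonZero⁻¹ b)) (0<fromℕ (ℕ.m^n>0 b k)))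
        (trans (cong (log₂ (fromℕ b) +_) (log₂-^ b k))
          (solve 2 (λ k l → l :+ k :* l := (con 1 :+ k) :* l) refl (fromℕ k) (log₂ (fromℕ b)))))

  log₂-2^ : ∀ k → log₂ (fromℕ (2 ℕ.^ k)) ≡ fromℕ k
  log₂-2^ k = trans (log₂-^ 2 k) (trans (cong (fromℕ k *_) log₂-2) (*-identityʳ _))

  -- From 2 ≤ (1 + 1/m)^m, i.e. 1/m ≤ log₂ (1 + 1/m).
  exponent≤log₂ : ∀ m k {R} → .{{ℕ.NonZero m}} → 0# < R →
                  fromℕ (suc m ℕ.^ k) ≤ fromℕ (m ℕ.^ k) * R → fromℕ k ≤ fromℕ m * log₂ R
  exponent≤log₂ m k {R} 0<R p =
    -- In `m` times `upper` plus `k` times `lower`, all terms with `A` and `B` cancel.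
    transfer-≤ (+-mono-≤ (*-monoʳ-≤ (0≤fromℕ m) upper) (*-monoʳ-≤ (0≤fromℕ k) lower))
      (solve 5 (λ k m A B l →
        k :+ (m :* (k :* B :+ l) :+ k :* (m :* A))
        := m :* l :+ (m :* (k :* A) :+ k :* (con 1 :+ m :* B)))
        refl (fromℕ k) (fromℕ m) A B (log₂ R))
    where
    A = log₂ (fromℕ (suc m))
    B = log₂ (fromℕ m)
    upper : fromℕ k * A ≤ fromℕ k * B + log₂ R
    upper = subst₂ _≤_ (log₂-^ (suc m) k)
      (trans (log₂-* (0<fromℕ (ℕ.m^n>0 m k)) 0<R) (cong (_+ log₂ R) (log₂-^ m k)))
      (log₂-mono-≤ (0<fromℕ (ℕ.m^n>0 (suc m) k)) p)
    lower : 1# + fromℕ m * B ≤ fromℕ m * A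
    lower = subst₂ _≤_
      (trans (cong log₂ (fromℕ-* 2 (m ℕ.^ m)))
        (trans (log₂-* (0<fromℕ {2} (ℕ.s≤s ℕ.z≤n)) (0<fromℕ (ℕ.m^n>0 m m)))
          (cong₂ _+_ log₂-2 (log₂-^ m m))))
      (log₂-^ (suc m) m)
      (log₂-mono-≤ (0<fromℕ (ℕ.<-≤-trans (ℕ.m^n>0 m m) (ℕ.m≤m+n _ _)))
        (fromℕ-mono-≤ (2*m^m≤[1+m]^m m)))

  1≤log⁺ : ∀ x → 1# ≤ log⁺ x
  1≤log⁺ x = subst (_≤ log⁺ x) log₂-2 (log₂-mono-≤ (0<fromℕ {2} (ℕ.s≤s ℕ.z≤n)) (x≤x⊔y (fromℕ 2) x))

  exponent≤log⁺ : ∀ k {x} → fromℕ (2 ℕ.^ k) ≤ fromℕ 2 ⊔ x → fromℕ k ≤ log⁺ x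
  exponent≤log⁺ k {x} p =
    subst (_≤ log⁺ x) (log₂-2^ k) (log₂-mono-≤ (0<fromℕ (ℕ.m^n>0 2 k)) p)

  0≤log₂-fromℕ : ∀ {n} → 1 ℕ.≤ n → 0# ≤ log₂ (fromℕ n)
  0≤log₂-fromℕ {n} 1≤n =
    subst (_≤ log₂ (fromℕ n)) log₂-1 (log₂-mono-≤ (0<fromℕ {1} (ℕ.s≤s ℕ.z≤n)) (fromℕ-mono-≤ 1≤n))

  -- The condition fails at L - 1, so 2^(2^(L - 1)) ≤ n; take logarithms twice.
  loglog-bound : ∀ n L → (∀ i → i ℕ.< L → ¬ n ℕ.< 2 ℕ.^ (2 ℕ.^ i)) →
                 fromℕ L ≤ 1# + log⁺ (log₂ (fromℕ n))
  loglog-bound n zero    _ = +-pres-0≤ 0≤1 (≤-trans 0≤1 (1≤log⁺ _))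
  loglog-bound n (suc L) below = +-monoʳ-≤ 1# (exponent≤log⁺ L
    (≤-trans
      (subst (_≤ log₂ (fromℕ n)) (log₂-2^ (2 ℕ.^ L))
        (log₂-mono-≤ (0<fromℕ (ℕ.m^n>0 2 (2 ℕ.^ L)))
          (fromℕ-mono-≤ (ℕ.≮⇒≥ (below L ℕ.≤-refl)))))
      (x≤y⊔x (fromℕ 2) (log₂ (fromℕ n)))))

  module _ {ε : ℝ} (0<ε : 0# < ε) where

    -- For m = 2^e this is (m - 1) ε ≥ 2, written as the negated loop test of `chooseScale`.
    Fine : ℕ → Set
    Fine e = ¬ fromℕ (2 ℕ.^ e) * ε < fromℕ 2 + ε

    private
      w = 1# / ε

      ε*w≡1 : ε * w ≡ 1#
      ε*w≡1 = x*[y/x]≡y 1# 0<ε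

    -- By the Archimedean property some N exceeds 2/ε + 1, and 2^N > N.
    ∃-fine : ∃ Fine
    ∃-fine with N , p ← archimedean (fromℕ 2 * w + 1#) = N , λ q →
      <⇒≱ q (≤-trans
        (≤-reflexive (trans
          (cong (λ z → z + ε) (sym (trans (cong (fromℕ 2 *_) (trans (*-comm w ε) ε*w≡1)) (*-identityʳ _))))
          (solve 3 (λ t w ε → t :* (w :* ε) :+ ε := (t :* w :+ con 1) :* ε) refl (fromℕ 2) w ε)))
        (*-monoˡ-≤ (<⇒≤ 0<ε) (≤-trans (<⇒≤ p) (fromℕ-mono-≤ (ℕ.<⇒≤ (n<2^n N))))))

    coarse-bound : ∀ e → ¬ Fine e → fromℕ (2 ℕ.^ e) ≤ fromℕ 2 * w + 1#
    coarse-bound e ¬fine = ≮⇒≥ λ r → ¬fine λ q → <⇒≱ q (<⇒≤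
      (subst₂ _<_
        (trans (solve 3 (λ t w ε → ε :* (t :* w :+ con 1) := t :* (ε :* w) :+ ε) refl (fromℕ 2) w ε)
          (cong (_+ ε) (trans (cong (fromℕ 2 *_) ε*w≡1) (*-identityʳ _))))
        (*-comm ε _)
        (*-monoʳ-< 0<ε r)))

    -- Half of the scale is still too coarse, so it is at most 2/ε + 1. Doubling gives 4/ε + 2,
    -- whence 6 = 4 + 2.
    scale-bound : ∀ e → (∀ i → i ℕ.< e → ¬ Fine i) → fromℕ (2 ℕ.^ e) ≤ fromℕ 6 * (1# ⊔ w)
    scale-bound zero _ =
      transfer-≤ (+-mono-≤ 1≤Z (*-pres-0≤ (0≤fromℕ 5) (≤-trans 0≤1 1≤Z)))
        (solve 2 (λ f Z → (con 1 :+ con 0) :+ (Z :+ f :* Z) := (con 1 :+ f) :* Z :+ (con 1 :+ con 0))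
          refl (fromℕ 5) (1# ⊔ w))
      where
      1≤Z : 1# ≤ 1# ⊔ w
      1≤Z = x≤x⊔y 1# w
    scale-bound (suc e) coarse =
      subst (_≤ fromℕ 6 * Z) (sym (fromℕ-* 2 (2 ℕ.^ e)))
        (transfer-≤ (+-mono-≤ (*-monoʳ-≤ (0≤fromℕ 2) (coarse-bound e (coarse e ℕ.≤-refl)))
                      (+-mono-≤ (*-monoʳ-≤ (0≤fromℕ 4) (x≤y⊔x 1# w)) (*-monoʳ-≤ (0≤fromℕ 2) (x≤x⊔y 1# w))))
          (solve 3 (λ p w Z →
            let one = con 1 ; two = one :+ (one :+ con 0) ; four = one :+ (one :+ two) in
            two :* p :+ (two :* (two :* w :+ one) :+ (four :* Z :+ two :* Z))
            := (one :+ (one :+ four)) :* Z :+ (two :* p :+ (four :* w :+ two :* one)))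
            refl (fromℕ (2 ℕ.^ e)) w Z))
      where Z = 1# ⊔ w

    -- Of the 3, one comes from passing to half of the scale, and two are the logarithm of the
    -- factor 4 in `bound`.
    exponent-bound : ∀ e → (∀ i → i ℕ.< e → ¬ Fine i) → fromℕ e ≤ fromℕ 3 + log⁺ w
    exponent-bound zero    _      = +-pres-0≤ (0≤fromℕ 3) (≤-trans 0≤1 (1≤log⁺ w))
    exponent-bound (suc e) coarse =
      subst (fromℕ (suc e) ≤_) (sym (+-assoc 1# (fromℕ 2) (log⁺ w)))
        (+-monoʳ-≤ 1# (subst₂ _≤_ (log₂-2^ e)
          (trans (log₂-* (0<fromℕ {4} (ℕ.s≤s ℕ.z≤n)) 0<Z) (cong (_+ log⁺ w) (log₂-2^ 2)))
          (log₂-mono-≤ (0<fromℕ (ℕ.m^n>0 2 e)) bound)))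
      where
      Z = fromℕ 2 ⊔ w
      2≤Z : fromℕ 2 ≤ Z
      2≤Z = x≤x⊔y (fromℕ 2) w
      0<Z : 0# < Z
      0<Z = <-≤-trans (0<fromℕ {2} (ℕ.s≤s ℕ.z≤n)) 2≤Z
      bound : fromℕ (2 ℕ.^ e) ≤ fromℕ 4 * Z
      bound = transfer-≤
        (+-mono-≤ (+-mono-≤ (coarse-bound e (coarse e ℕ.≤-refl)) (*-monoʳ-≤ (0≤fromℕ 2) (x≤y⊔x (fromℕ 2) w)))
                  (+-mono-≤ (+-mono-≤ 2≤Z (<⇒≤ 0<Z)) 0≤1))
        (solve 3 (λ p w Z →
          let one = con 1 ; two = one :+ (one :+ con 0) in
          p :+ (two :* w :+ one :+ two :* Z :+ (Z :+ Z :+ one))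
          := (one :+ (one :+ two)) :* Z :+ (p :+ two :* w :+ (two :+ con 0 :+ con 0)))
          refl (fromℕ (2 ℕ.^ e)) w Z)

    -- Here the scale is m + 1. The last hypothesis says m T ≤ (m + 2) S, and 2 ≤ m ε turns the
    -- right side into at most m (1 + ε) S.
    approximation : ∀ m S T → fromℕ 2 + ε ≤ fromℕ (suc m) * ε → 0# ≤ S → S ≤ T →
                    fromℕ (suc m) * T ≤ fromℕ (suc (suc m)) * S + T →
                    T IsApproximation[1+ ε ]Of S
    approximation m S T fine 0≤S S≤T p =
      ≤-trans (subst (1# / (1# + ε) * S ≤_) (*-identityˡ S) (*-monoˡ-≤ 0≤S inverse≤1)) S≤T
      , *-cancelˡ-≤ 0<ν (transfer-≤ (+-mono-≤ p (*-monoˡ-≤ 0≤S fine))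
          (solve 4 (λ ν ε S T →
            let one = con 1 ; two = one :+ (one :+ con 0) in
            ν :* T :+ ((one :+ (one :+ ν)) :* S :+ T :+ (one :+ ν) :* ε :* S)
            := ν :* ((one :+ ε) :* S) :+ ((one :+ ν) :* T :+ (two :+ ε) :* S))
            refl ν ε S T))
      where
      ν = fromℕ m
      0<ν : 0# < ν
      0<ν = *-cancelˡ-< (<⇒≤ 0<ε) (subst (_< ε * ν) (sym (zeroʳ ε))
        (<-≤-trans (0<fromℕ {2} (ℕ.s≤s ℕ.z≤n)) (transfer-≤ fine
          (solve 3 (λ t ε ν → t :+ (con 1 :+ ν) :* ε := ε :* ν :+ (t :+ ε)) refl (fromℕ 2) ε ν))))
      0<1+ε : 0# < 1# + ε
      0<1+ε = <-≤-trans 0<1 (subst (_≤ 1# + ε) (+-identityʳ 1#) (+-monoʳ-≤ 1# (<⇒≤ 0<ε)))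
      inverse≤1 : 1# / (1# + ε) ≤ 1#
      inverse≤1 = *-cancelˡ-≤ 0<1+ε (subst₂ _≤_ (sym (x*[y/x]≡y 1# 0<1+ε)) (sym (*-identityʳ _))
        (subst (_≤ 1# + ε) (+-identityʳ 1#) (+-monoʳ-≤ 1# (<⇒≤ 0<ε))))

    -- Each jump will cost O(1 + e + L) steps. The two factors are bounded separately by 4 and 6
    -- times the factors of `timeBound`, whence 24.
    time-bound : ∀ n e L K r → 1 ℕ.≤ n → 0# ≤ log₂ r →
      (∀ i → i ℕ.< e → ¬ Fine i) → (∀ i → i ℕ.< L → ¬ n ℕ.< 2 ℕ.^ (2 ℕ.^ i)) →
      fromℕ (K ℕ.∸ 2) ≤ fromℕ (2 ℕ.^ e) * log₂ (fromℕ n) →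
      fromℕ (K ℕ.∸ 2) ≤ fromℕ (2 ℕ.^ e) * log₂ r →
      fromℕ (suc (e ℕ.+ L) ℕ.* suc K) ≤ fromℕ 24 * timeBound n ε r
    time-bound n e L K r 1≤n 0≤log coarse below K≤n K≤r =
      subst₂ _≤_ (sym (fromℕ-* (suc (e ℕ.+ L)) (suc K)))
        (trans (solve 4 (λ a b X Y → a :* Y :* (b :* X) := a :* b :* (X :* Y))
                 refl (fromℕ 4) (fromℕ 6) X Y)
               (cong (_* (X * Y)) (sym (fromℕ-* 4 6))))
        (*-mono-≤ (0≤fromℕ (suc K)) (*-pres-0≤ (0≤fromℕ 4) (≤-trans 0≤1 1≤Y)) probes jumps)
      where
      Z = 1# ⊔ w
      l = log₂ (fromℕ n) ⊓ log₂ r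
      X = 1# + Z * l
      A = log⁺ w
      B = log⁺ (log₂ (fromℕ n))
      Y = A + B
      min-case : (P : ℝ → Set) → P (log₂ (fromℕ n)) → P (log₂ r) → P l
      min-case P p q with ⊓-sel (log₂ (fromℕ n)) (log₂ r)
      ... | inj₁ eq = subst P (sym eq) p
      ... | inj₂ eq = subst P (sym eq) q
      0≤l : 0# ≤ l
      0≤l = min-case (0# ≤_) (0≤log₂-fromℕ 1≤n) 0≤log
      1≤Y : 1# ≤ Y
      1≤Y = subst (_≤ Y) (+-identityʳ 1#) (+-mono-≤ (1≤log⁺ w) (≤-trans 0≤1 (1≤log⁺ _)))
      -- The left side is at most 5 + Y, and 5 ≤ 3 Y because both logarithms in `Y` are at least 1.
      probes : fromℕ (suc (e ℕ.+ L)) ≤ fromℕ 4 * Y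
      probes = subst (λ z → 1# + z ≤ fromℕ 4 * Y) (sym (fromℕ-+ e L))
        (transfer-≤
          (+-mono-≤ (+-mono-≤ (exponent-bound e coarse) (loglog-bound n L below))
            (+-mono-≤ (*-monoʳ-≤ (0≤fromℕ 3) (+-mono-≤ (1≤log⁺ w) (1≤log⁺ (log₂ (fromℕ n))))) 0≤1))
          (solve 4 (λ e L A B →
            let one = con 1 ; three = one :+ (one :+ (one :+ con 0)) in
            one :+ (e :+ L) :+ (three :+ A :+ (one :+ B) :+ (three :* (A :+ B) :+ one))
            := (one :+ three) :* (A :+ B) :+ (e :+ L :+ (three :* (one :+ one) :+ con 0)))
            refl (fromℕ e) (fromℕ L) A B))
      -- Truncated subtraction gives K + 1 ≤ 3 + (K - 2); the summand 1 of `X` absorbs the 3.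
      jumps : fromℕ (suc K) ≤ fromℕ 6 * X
      jumps = ≤-trans
        (subst (fromℕ (suc K) ≤_) (fromℕ-+ 3 (K ℕ.∸ 2)) (fromℕ-mono-≤ {suc K} {3 ℕ.+ (K ℕ.∸ 2)} (ℕ.s≤s (ℕ.m≤n+m∸n K 2))))
        (transfer-≤ (+-mono-≤ (min-case (λ z → fromℕ (K ℕ.∸ 2) ≤ fromℕ (2 ℕ.^ e) * z) K≤n K≤r)
                      (+-mono-≤ (*-monoˡ-≤ 0≤l (scale-bound e coarse)) (0≤fromℕ 3)))
          (solve 4 (λ k p Z l →
            let one = con 1 ; three = one :+ (one :+ (one :+ con 0)) ; six = one :+ (one :+ (one :+ three)) in
            three :+ k :+ (p :* l :+ (six :* Z :* l :+ three))
            := six :* (one :+ Z :* l) :+ (k :+ (p :* l :+ con 0)))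
            refl (fromℕ (K ℕ.∸ 2)) (fromℕ (2 ℕ.^ e)) Z l))

-- The program.

-- Cell 10 + j of the naturals holds 2^(2^j).  Of the reals, cell 0 holds ε and then
-- the estimate, cell 1 the value at rank c, and cell 2 the value last probed.
pattern #n     = nat (lit 0)
pattern #m     = nat (lit 1)
pattern #c     = nat (lit 2)
pattern #b     = nat (lit 3)
pattern #flag  = nat (lit 4)
pattern #k     = nat (lit 5)
pattern #p     = nat (lit 6)
pattern #u     = nat (lit 7)
pattern #j     = nat (lit 8)
pattern #pos   = nat (lit 9)

-- The shift by 1 lets the trial k = 1, which looks at rank c itself, always succeed.
probe : Program
probe =
  nat[ lit 9 ]≔ #c ⊕ (#k ⊖ lit 1) ⊗ #b ⨾
  if nat≺ #pos #n then
    -- Ranks count down from the largest element, while the list is increasing and indexed from 0.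
    real[ lit 2 ]≔query #n ⊖ (lit 1 ⊕ #pos) ⨾
    if real≺ (cast (lit 1 ⊕ #m) ⊗ real (lit 2)) (cast #m ⊗ real (lit 1)) then
      nat[ lit 4 ]≔ lit 0
    else
      nat[ lit 4 ]≔ lit 1
    fi
  else
    nat[ lit 4 ]≔ lit 0
  fi

-- The squares are kept in memory because `descend` reads them again in reverse order.
ascend : Program
ascend =
  nat[ lit 8 ]≔ lit 0 ⨾
  nat[ lit 10 ]≔ lit 2 ⨾
  nat[ lit 5 ]≔ lit 2 ⨾
  probe ⨾
  while nat≺ (lit 0) #flag loop
    nat[ lit 11 ⊕ #j ]≔ nat (lit 10 ⊕ #j) ⊗ nat (lit 10 ⊕ #j) ⨾
    nat[ lit 8 ]≔ lit 1 ⊕ #j ⨾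
    nat[ lit 5 ]≔ nat (lit 10 ⊕ #j) ⨾
    probe
  end

accept : Program
accept = if nat≺ (lit 0) #flag then nat[ lit 6 ]≔ #k else skip fi

-- The exponent of the power of two in `#p` is built from its highest binary digit down: multiplying
-- by 2^(2^j) sets digit j.
descend : Program
descend =
  nat[ lit 6 ]≔ lit 1 ⨾
  while nat≺ (lit 0) #j loop
    nat[ lit 8 ]≔ #j ⊖ lit 1 ⨾
    nat[ lit 5 ]≔ #p ⊗ nat (lit 10 ⊕ #j) ⨾
    probe ⨾
    accept
  end

-- The loop goes on while u > 1 and u m > p; both differences are truncated.
refine : Program
refine =
  nat[ lit 7 ]≔ #p ⨾
  while nat≺ (lit 0) ((#u ⊖ lit 1) ⊗ (#u ⊗ #m ⊖ #p)) loop
    nat[ lit 7 ]≔ #u ⊘ lit 2 ⨾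
    nat[ lit 5 ]≔ #p ⊕ #u ⨾
    probe ⨾
    accept
  end

-- Trial `#p ⊕ #u` is known to fail, and the jump ends at the rank it looks at, cut off at `#n`.
move : Program
move =
  nat[ lit 5 ]≔ #c ⊕ ((#p ⊕ #u) ⊖ lit 1) ⊗ #b ⨾
  if nat≺ #n #k then nat[ lit 5 ]≔ #n else skip fi ⨾
  real[ lit 0 ]≔ real (lit 0) ⊕ cast (#k ⊖ #c) ⊗ real (lit 1) ⨾
  nat[ lit 2 ]≔ #k

step : Program
step =
  nat[ lit 3 ]≔ lit 1 ⊕ (#c ⊘ #m) ⨾
  real[ lit 1 ]≔query #n ⊖ (lit 1 ⊕ #c) ⨾
  ascend ⨾ descend ⨾ refine ⨾ move

chooseScale : Program
chooseScale =
  nat[ lit 1 ]≔ lit 1 ⨾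
  while real≺ (cast #m ⊗ real (lit 0)) (cast (lit 2) ⊕ real (lit 0)) loop
    nat[ lit 1 ]≔ lit 2 ⊗ #m
  end

approximateSum : Program
approximateSum =
  chooseScale ⨾
  real[ lit 0 ]≔ cast (lit 0) ⨾
  -- Cell 2 still has its initial value 0, so the walk starts at rank 0.
  while nat≺ #c #n loop step end

-- For the cost of a loop with a prologue: the constants are compared by evaluation, while the cost
-- `x` of the iterations stays symbolic.
slack : ∀ k x l → {T (k ℕ.+ l ℕ.≤ᵇ 100)} → k ℕ.+ (x ℕ.+ l) ℕ.≤ 100 ℕ.+ x
slack k x l {p} = ℕ.≤-trans (ℕ.≤-reflexive (lemma k x l)) (ℕ.+-monoˡ-≤ x (ℕ.≤ᵇ⇒≤ (k ℕ.+ l) 100 p))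
  where
  lemma : ∀ k x l → k ℕ.+ (x ℕ.+ l) ≡ k ℕ.+ l ℕ.+ x
  lemma = ℕ-Solver.solve-∀

module _ {A : Set} (f : ℕ → A) (k : ℕ) (x : A) where

  update-≡ : (f [ k ↦ x ]) k ≡ x
  update-≡ rewrite dec-true (k ℕ.≟ k) refl = refl

  update-≢ : ∀ {i} → i ≢ k → (f [ k ↦ x ]) i ≡ f i
  update-≢ {i} i≢k rewrite dec-false (i ℕ.≟ k) i≢k = refl

-- A program logic with time bounds.

module Execution (𝓡 : RealNumbers) {n : ℕ} (a : Vector (RealNumbers.ℝ 𝓡) n) where
  open RealNumbers 𝓡
  open OrderedFieldProperties orderedField using (_<?_)
  open Machine 𝓡

  -- A Hoare triple for total correctness within time `B`, with a single starting state in place of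
  -- a precondition.
  record Runs (P : Program) (σ : State) (B : ℕ) (Q : State → Set) : Set where
    constructor run
    field
      {time}  : ℕ
      {final} : State
      trace   : a ⊢ P , σ ⇓ time , final
      time≤   : time ℕ.≤ B
      result  : Q final

  within′ : ∀ {P σ B Q B′} → B ℕ.≤ B′ → Runs P σ B Q → Runs P σ B′ Q
  within′ B≤B′ (run d t≤ q) = run d (ℕ.≤-trans t≤ B≤B′) q

  within : ∀ {P σ B Q} B′ → {T (B ℕ.≤ᵇ B′)} → Runs P σ B Q → Runs P σ B′ Q
  within {B = B} B′ {p} = within′ (ℕ.≤ᵇ⇒≤ B B′ p)

  concludes : ∀ {P σ B Q R} → Runs P σ B Q → (∀ σ′ → Q σ′ → R σ′) → Runs P σ B R
  concludes (run d t≤ q) f = run d t≤ (f _ q)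

  holds? : ∀ b σ → Dec (Holds b σ)
  holds? (nat≺ d e)  σ = ⟦ d ⟧ₙ σ ℕ.<? ⟦ e ⟧ₙ σ
  holds? (real≺ d e) σ = ⟦ d ⟧ᵣ σ <? ⟦ e ⟧ᵣ σ

  skips : ∀ {σ} {Q : State → Set} → Q σ → Runs skip σ 1 Q
  skips q = run ⇓skip ℕ.≤-refl q

  setsNat : ∀ {σ d e} {Q : State → Set} → Q (setNat (⟦ d ⟧ₙ σ) (⟦ e ⟧ₙ σ) σ) →
            Runs (nat[ d ]≔ e) σ (suc (natCost d ℕ.+ natCost e)) Q
  setsNat q = run ⇓nat ℕ.≤-refl q

  setsReal : ∀ {σ d e} {Q : State → Set} → Q (setReal (⟦ d ⟧ₙ σ) (⟦ e ⟧ᵣ σ) σ) →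
             Runs (real[ d ]≔ e) σ (suc (natCost d ℕ.+ realCost e)) Q
  setsReal q = run ⇓real ℕ.≤-refl q

  queries : ∀ {σ d e} {Q : State → Set} (i : Fin n) → ⟦ e ⟧ₙ σ ≡ toℕ i →
            Q (setReal (⟦ d ⟧ₙ σ) (a i) σ) →
            Runs (real[ d ]≔query e) σ (suc (natCost d ℕ.+ natCost e)) Q
  queries i eq q = run (⇓query i eq) ℕ.≤-refl q

  infixr 3 _⨟_
  _⨟_ : ∀ {P P′ σ s t Q R} → Runs P σ s Q → (∀ {σ′} → Q σ′ → Runs P′ σ′ t R) →
        Runs (P ⨾ P′) σ (s ℕ.+ t) R
  run d s≤ q ⨟ next with run d′ t≤ r ← next q = run (⇓seq d d′) (ℕ.+-mono-≤ s≤ t≤) r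

  branches : ∀ {b P P′ σ B Q} → (Holds b σ → Runs P σ B Q) → (¬ Holds b σ → Runs P′ σ B Q) →
             Runs (if b then P else P′ fi) σ (testCost b ℕ.+ B) Q
  branches {b} {σ = σ} yes-case no-case with holds? b σ
  ... | yes h with run d t≤ q ← yes-case h = run (⇓then h d) (ℕ.+-monoʳ-≤ (testCost b) t≤) q
  ... | no ¬h with run d t≤ q ← no-case ¬h = run (⇓else ¬h d) (ℕ.+-monoʳ-≤ (testCost b) t≤) q

  -- The index of the invariant bounds the number of iterations still to come. It is existential at
  -- the end, as the loop may stop before it is used up.
  loops : ∀ {b P B} (Inv : ℕ → State → Set) →
          (∀ f σ → Inv (suc f) σ → Holds b σ → Runs P σ B (Inv f)) →
          (∀ σ → Inv 0 σ → ¬ Holds b σ) →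
          ∀ f σ → Inv f σ →
          Runs (while b loop P end) σ (f ℕ.* (testCost b ℕ.+ B) ℕ.+ testCost b)
            (λ σ′ → ¬ Holds b σ′ × ∃ λ f′ → Inv f′ σ′)
  loops {b} Inv body stop zero σ inv =
    run (⇓exit (stop σ inv)) ℕ.≤-refl (stop σ inv , zero , inv)
  loops {b} {B = B} Inv body stop (suc f) σ inv with holds? b σ
  ... | no ¬h = run (⇓exit ¬h) (ℕ.m≤n+m _ _) (¬h , suc f , inv)
  ... | yes h with run d s≤ inv′ ← body f σ inv h
              with run d′ t≤ q ← loops Inv body stop f _ inv′ =
    run (⇓iterate h d d′)
      (ℕ.≤-trans (ℕ.+-monoʳ-≤ (testCost b) (ℕ.+-mono-≤ s≤ t≤))
        (ℕ.≤-reflexive (lemma (testCost b) B (f ℕ.* (testCost b ℕ.+ B)))))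
      q
    where
    lemma : ∀ c B x → c ℕ.+ (B ℕ.+ (x ℕ.+ c)) ≡ c ℕ.+ B ℕ.+ x ℕ.+ c
    lemma = ℕ-Solver.solve-∀

-- The search for the length of a jump.

module Search (𝓡 : RealNumbers) {n : ℕ} (a : Vector (RealNumbers.ℝ 𝓡) n)
  (v : ℕ → RealNumbers.ℝ 𝓡)
  (entry : ∀ x → x ℕ.< n → ∃ λ i → n ℕ.∸ suc x ≡ toℕ i × a i ≡ v x)
  (nonneg : ∀ x → RealNumbers._≤_ 𝓡 (RealNumbers.0# 𝓡) (v x)) (μ : ℕ) where
  open RealNumbers 𝓡
  open OrderedFieldProperties orderedField
  open Machine 𝓡
  open Execution 𝓡 a

  -- A successor, so that `quotient` by it unfolds to `ℕ./`.
  m : ℕ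
  m = suc μ

  Context : ℕ → ℕ → ℝ → State → Set
  Context c b T σ = nats σ 0 ≡ n × nats σ 1 ≡ m × nats σ 2 ≡ c × nats σ 3 ≡ b ×
                    reals σ 0 ≡ T × reals σ 1 ≡ v c

  Reaches : ℕ → ℕ → ℕ → Set
  Reaches c b k = x ℕ.< n × fromℕ m * v c ≤ fromℕ (suc m) * v x
    where x = c ℕ.+ (k ℕ.∸ 1) ℕ.* b

  -- What the search has to deliver. The last condition keeps the uncertain range short: it is a
  -- single block, whose length is about c/m, or at most κ/m blocks.
  Bracket : ℕ → ℕ → ℕ → ℕ → Set
  Bracket c b κ w = 1 ℕ.≤ κ × 1 ℕ.≤ w × Reaches c b κ × ¬ Reaches c b (κ ℕ.+ w) ×
    (w ≡ 1 ⊎ w ℕ.* m ℕ.≤ κ)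

  -- The final states are explicit in the memory of naturals, so that callers see by computation
  -- that all cells except 4 and 9 keep their values.
  probe-runs : ∀ {c b T σ} {Q : State → Set} → Context c b T σ →
    (∀ {x ρ} → let σ′ = ⟨ (nats σ [ 9 ↦ x ]) [ 4 ↦ 1 ] , ρ ⟩ in
       Context c b T σ′ → Reaches c b (nats σ 5) → Q σ′) →
    (∀ {x ρ} → let σ′ = ⟨ (nats σ [ 9 ↦ x ]) [ 4 ↦ 0 ] , ρ ⟩ in
       Context c b T σ′ → ¬ Reaches c b (nats σ 5) → Q σ′) →
    Runs probe σ 50 Q
  probe-runs {σ = σ} (n≡ , m≡ , refl , refl , refl , v≡) reached missed = within 50
    -- The intermediate assertion pins the state down; after matching on `refl`, lookups in it
    -- compute.
    (_⨟_ {Q = λ σ′ → σ′ ≡ setNat 9 x σ} (setsNat refl) λ { refl → branches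
      (λ x<n′ → let x<n = subst (x ℕ.<_) n≡ x<n′
                    i , i≡ , a≡v = entry x x<n
                in _⨟_ {Q = λ σ′ → σ′ ≡ setReal 2 (v x) (setNat 9 x σ)}
        (queries i (trans (cong (ℕ._∸ suc x) n≡) i≡) (cong (λ y → setReal 2 y (setNat 9 x σ)) a≡v))
        λ { refl → branches
          (λ below → setsNat (missed (n≡ , m≡ , refl , refl , refl , v≡) λ (_ , near) →
            <⇒≱ (subst₂ (λ k z → fromℕ (suc k) * v x < fromℕ k * z) m≡ v≡ below) near))
          (λ above → setsNat (reached (n≡ , m≡ , refl , refl , refl , v≡)
            (x<n , subst₂ (λ k z → fromℕ k * z ≤ fromℕ (suc k) * v x) m≡ v≡ (≮⇒≥ above)))) })
      (λ x≮n → within 27 (setsNat (missed (n≡ , m≡ , refl , refl , refl , v≡)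
        λ (x<n , _) → x≮n (subst (x ℕ.<_) (sym n≡) x<n)))) })
    where x = nats σ 2 ℕ.+ (nats σ 5 ℕ.∸ 1) ℕ.* nats σ 3

  tower : ℕ → ℕ
  tower j = 2 ℕ.^ (2 ℕ.^ j)

  tower-suc : ∀ j → tower j ℕ.* tower j ≡ tower (suc j)
  tower-suc j = trans (sym (ℕ.^-distribˡ-+-* 2 (2 ℕ.^ j) (2 ℕ.^ j)))
                      (cong (λ z → 2 ℕ.^ (2 ℕ.^ j ℕ.+ z)) (sym (ℕ.+-identityʳ (2 ℕ.^ j))))

  Stored : ℕ → State → Set
  Stored j σ = ∀ i → i ℕ.≤ j → nats σ (10 ℕ.+ i) ≡ tower i

  module _ {c β : ℕ} {T₀ : ℝ} (L : ℕ) (n<tower : n ℕ.< tower L) where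

    private
      b = suc β
      Ctx = Context c b T₀

    -- Blocks are nonempty, so this trial looks beyond the end of the list. Hence `ascend` squares
    -- at most `L` times.
    ¬reaches-tower : ¬ Reaches c b (tower L)
    ¬reaches-tower (pos<n , _) = ℕ.<-irrefl refl (begin-strict
      tower L                              ≡⟨ ℕ.m+[n∸m]≡n (ℕ.m^n>0 2 (2 ℕ.^ L)) ⟨
      suc (tower L ℕ.∸ 1)                  ≤⟨ ℕ.s≤s (ℕ.m≤m*n (tower L ℕ.∸ 1) b) ⟩
      suc ((tower L ℕ.∸ 1) ℕ.* b)          ≤⟨ ℕ.s≤s (ℕ.m≤n+m _ c) ⟩
      suc (c ℕ.+ (tower L ℕ.∸ 1) ℕ.* b)    ≤⟨ pos<n ⟩
      n                                    <⟨ n<tower ⟩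
      tower L                              ∎)
      where open ℕ.≤-Reasoning

    Verdict : ℕ → State → Set
    Verdict k σ = nats σ 4 ≡ 1 × Reaches c b k ⊎ nats σ 4 ≡ 0 × ¬ Reaches c b k

    Ascending : ℕ → State → Set
    Ascending f σ = ∃ λ j → f ℕ.+ j ≡ L × Ctx σ × nats σ 8 ≡ j × Stored j σ × Verdict (tower j) σ

    Ascended : State → Set
    Ascended σ = ∃ λ j → j ℕ.≤ L × Ctx σ × nats σ 8 ≡ j × Stored j σ × ¬ Reaches c b (tower j)

    ascending-step : ∀ f σ → Ascending (suc f) σ → 0 ℕ.< nats σ 4 →
      Runs (nat[ lit 11 ⊕ #j ]≔ nat (lit 10 ⊕ #j) ⊗ nat (lit 10 ⊕ #j) ⨾
            nat[ lit 8 ]≔ lit 1 ⊕ #j ⨾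
            nat[ lit 5 ]≔ nat (lit 10 ⊕ #j) ⨾
            probe) σ 100 (Ascending f)
    ascending-step f σ (j , f+j≡L , ctx , refl , stored , _) _ = within 100
      (_⨟_ {Q = λ σ′ → σ′ ≡ σ₁} (setsNat refl) λ { refl →
       _⨟_ {Q = λ σ′ → σ′ ≡ σ₂} (setsNat refl) λ { refl →
       _⨟_ {Q = λ σ′ → σ′ ≡ σ₃} (setsNat refl) λ { refl →
       probe-runs ctx
         (λ ctx′ r → suc j , f+1+j≡L , ctx′ , refl , stored′ , inj₁ (refl , subst (Reaches c b) new r))
         (λ ctx′ r → suc j , f+1+j≡L , ctx′ , refl , stored′ ,
            inj₂ (refl , λ r′ → r (subst (Reaches c b) (sym new) r′))) }}})
      where
      x = nats σ (10 ℕ.+ j) ℕ.* nats σ (10 ℕ.+ j)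
      σ₁ = setNat (11 ℕ.+ j) x σ
      σ₂ = setNat 8 (suc j) σ₁
      σ₃ = setNat 5 (nats σ₂ (11 ℕ.+ j)) σ₂
      f+1+j≡L = trans (ℕ.+-suc f j) f+j≡L
      new : nats σ₁ (11 ℕ.+ j) ≡ tower (suc j)
      new = trans (update-≡ (nats σ) (11 ℕ.+ j) x)
              (trans (cong₂ ℕ._*_ (stored j ℕ.≤-refl) (stored j ℕ.≤-refl)) (tower-suc j))
      stored′ : Stored (suc j) σ₁
      stored′ i i≤1+j with ℕ.m≤n⇒m<n∨m≡n i≤1+j
      ... | inj₂ refl  = new
      ... | inj₁ i<1+j = trans (update-≢ (nats σ) (11 ℕ.+ j) x λ eq →
                                  ℕ.<-irrefl (ℕ.+-cancelˡ-≡ 10 i (suc j) (trans eq (sym (ℕ.+-suc 10 j)))) i<1+j)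
                               (stored i (ℕ.≤-pred i<1+j))

    ascending-stop : ∀ σ → Ascending 0 σ → ¬ 0 ℕ.< nats σ 4
    ascending-stop _ (_ , refl , _ , _ , _ , inj₁ (_ , reached))   _   = ¬reaches-tower reached
    ascending-stop _ (_ , _ , _ , _ , _ , inj₂ (flag≡0 , _)) 0<flag = ℕ.<-irrefl (sym flag≡0) 0<flag

    ascended : ∀ σ → (¬ 0 ℕ.< nats σ 4) × ∃ (λ f → Ascending f σ) → Ascended σ
    ascended _ (0≮flag , f , j , f+j≡L , ctx , j≡ , stored , inj₁ (flag≡1 , _)) =
      contradiction (subst (0 ℕ.<_) (sym flag≡1) (ℕ.s≤s ℕ.z≤n)) 0≮flag
    ascended _ (0≮flag , f , j , f+j≡L , ctx , j≡ , stored , inj₂ (_ , missed)) =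
      j , subst (j ℕ.≤_) f+j≡L (ℕ.m≤n+m j f) , ctx , j≡ , stored , missed

    ascend-runs : ∀ {σ} → Ctx σ → Runs ascend σ (100 ℕ.+ L ℕ.* 104) Ascended
    -- 59 pays for three assignments and the first probe, 104 for each test and iteration, 4 for the
    -- last test.
    ascend-runs {σ} ctx = within′ (slack 59 (L ℕ.* 104) 4)
      (_⨟_ {Q = λ σ′ → σ′ ≡ σ₁} (setsNat refl) λ { refl →
       _⨟_ {Q = λ σ′ → σ′ ≡ σ₂} (setsNat refl) λ { refl →
       _⨟_ {Q = λ σ′ → σ′ ≡ σ₃} (setsNat refl) λ { refl →
       _⨟_ {Q = Ascending L}
         (probe-runs ctx
         (λ ctx′ r → 0 , ℕ.+-identityʳ L , ctx′ , refl , stored , inj₁ (refl , r))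
         (λ ctx′ r → 0 , ℕ.+-identityʳ L , ctx′ , refl , stored , inj₂ (refl , r)))
       λ {σ′} inv → concludes (loops Ascending ascending-step ascending-stop L σ′ inv) ascended }}})
      where
      σ₁ = setNat 8 0 σ
      σ₂ = setNat 10 2 σ₁
      σ₃ = setNat 5 2 σ₂
      stored : Stored 0 σ₂
      stored zero _ = refl
      stored (suc i) ()

    -- The low `f` binary digits of the exponent are still open: exponent q succeeds and exponent q
    -- + 2^f fails. For f = 0 this is a doubling.
    Descending : ℕ → State → Set
    Descending f σ = Ctx σ × nats σ 8 ≡ f × Stored f σ ×
      ∃ λ q → nats σ 6 ≡ 2 ℕ.^ q × Reaches c b (2 ℕ.^ q) × ¬ Reaches c b (2 ℕ.^ q ℕ.* tower f)

    Descended : State → Set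
    Descended σ = Ctx σ ×
      ∃ λ q → nats σ 6 ≡ 2 ℕ.^ q × Reaches c b (2 ℕ.^ q) × ¬ Reaches c b (2 ℕ.^ q ℕ.+ 2 ℕ.^ q)

    accept-yes : ∀ {σ Q} → nats σ 4 ≡ 1 → Q (setNat 6 (nats σ 5) σ) → Runs accept σ 10 Q
    accept-yes flag≡1 q = within 10 (branches (λ _ → setsNat q)
      λ 0≮flag → contradiction (subst (0 ℕ.<_) (sym flag≡1) (ℕ.s≤s ℕ.z≤n)) 0≮flag)

    accept-no : ∀ {σ Q} → nats σ 4 ≡ 0 → Q σ → Runs accept σ 10 Q
    accept-no flag≡0 q = within 10 (branches {B = 4}
      (λ 0<flag → contradiction 0<flag (ℕ.<-irrefl (sym flag≡0)))
      λ _ → within 4 (skips q))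

    descending-step : ∀ f σ → Descending (suc f) σ → 0 ℕ.< nats σ 8 →
      Runs (nat[ lit 8 ]≔ #j ⊖ lit 1 ⨾
            nat[ lit 5 ]≔ #p ⊗ nat (lit 10 ⊕ #j) ⨾
            probe ⨾
            accept) σ 100 (Descending f)
    descending-step f σ (ctx , j≡ , stored , q , p≡ , reached , missed) _ = within 100
      (_⨟_ {Q = λ σ′ → σ′ ≡ σ₁} (setsNat (cong (λ z → setNat 8 z σ) (cong (ℕ._∸ 1) j≡))) λ { refl →
       _⨟_ {Q = λ σ′ → σ′ ≡ σ₂} (setsNat refl) λ { refl →
       _⨟_ {Q = λ σ′ → Runs accept σ′ 10 (Descending f)}
         (probe-runs ctx
           (λ ctx′ r → accept-yes refl
             (ctx′ , refl , stored′ , q ℕ.+ 2 ℕ.^ f , k≡ , subst (Reaches c b) k≡ r ,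
              -- Raising the exponent by 2^f a second time leads to q + 2^(f + 1), which is known to
              -- fail.
              λ r′ → missed (subst (Reaches c b)
                (trans (cong (ℕ._* tower f) (ℕ.^-distribˡ-+-* 2 q (2 ℕ.^ f)))
                  (trans (ℕ.*-assoc (2 ℕ.^ q) (tower f) (tower f)) (cong (2 ℕ.^ q ℕ.*_) (tower-suc f))))
                r′)))
           (λ ctx′ r → accept-no refl
             (ctx′ , refl , stored′ , q , p≡ , reached ,
              λ r′ → r (subst (Reaches c b) (sym k≡′) r′))))
         λ r → r }})
      where
      σ₁ = setNat 8 f σ
      k = nats σ 6 ℕ.* nats σ (10 ℕ.+ f)
      σ₂ = setNat 5 k σ₁
      stored′ : Stored f σ
      stored′ i i≤f = stored i (ℕ.≤-trans i≤f (ℕ.n≤1+n f))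
      k≡′ : k ≡ 2 ℕ.^ q ℕ.* tower f
      k≡′ = cong₂ ℕ._*_ p≡ (stored′ f ℕ.≤-refl)
      k≡ : k ≡ 2 ℕ.^ (q ℕ.+ 2 ℕ.^ f)
      k≡ = trans k≡′ (sym (ℕ.^-distribˡ-+-* 2 q (2 ℕ.^ f)))

    descend-runs : ∀ {σ} → c ℕ.< n → Ascended σ → Runs descend σ (100 ℕ.+ L ℕ.* 104) Descended
    descend-runs {σ} c<n (j , j≤L , ctx , j≡ , stored , missed) =
      within′ (ℕ.≤-trans (slack 3 (j ℕ.* 104) 4) (ℕ.+-monoʳ-≤ 100 (ℕ.*-monoˡ-≤ 104 j≤L)))
      (_⨟_ {Q = Descending j}
        (setsNat (ctx , j≡ , stored , 0 , refl , reaches-1 ,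
          λ r → missed (subst (Reaches c b) (ℕ.*-identityˡ (tower j)) r)))
        λ {σ′} inv → concludes (loops Descending descending-step (λ _ (_ , j≡0 , _) → ℕ.<-irrefl (sym j≡0)) j σ′ inv)
          descended)
      where
      reaches-1 : Reaches c b 1
      reaches-1 = subst (ℕ._< n) (sym (ℕ.+-identityʳ c)) c<n
        , subst (λ z → fromℕ m * v c ≤ fromℕ (suc m) * v z) (sym (ℕ.+-identityʳ c))
            (*-monoˡ-≤ (nonneg c) (fromℕ-mono-≤ (ℕ.n≤1+n m)))
      descended : ∀ σ → (¬ 0 ℕ.< nats σ 8) × ∃ (λ f → Descending f σ) → Descended σ
      descended _ (_ , zero , ctx , _ , _ , q , p≡ , reached , missed) =
        ctx , q , p≡ , reached , λ r → missed (subst (Reaches c b) (lemma (2 ℕ.^ q)) r)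
        where
        lemma : ∀ p → p ℕ.+ p ≡ p ℕ.* 2
        lemma = ℕ-Solver.solve-∀
      descended _ (0≮j , suc f , _ , j≡ , _) =
        contradiction (subst (0 ℕ.<_) (sym j≡) (ℕ.s≤s ℕ.z≤n)) 0≮j

    module _ (e : ℕ) (m≡2^e : m ≡ 2 ℕ.^ e) where

      -- The final inequality says that after `f` more halvings the window is at most κ/m. At the
      -- start κ and the window are equal, so that `e` halvings suffice.
      Refining : ℕ → State → Set
      Refining f σ = Ctx σ × ∃ λ q → ∃ λ κ → nats σ 7 ≡ 2 ℕ.^ q × nats σ 6 ≡ κ × 1 ℕ.≤ κ ×
        Reaches c b κ × ¬ Reaches c b (κ ℕ.+ 2 ℕ.^ q) × 2 ℕ.^ q ℕ.* m ℕ.≤ 2 ℕ.^ f ℕ.* κ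

      Refined : State → Set
      Refined σ = Ctx σ × ∃ λ κ → ∃ λ w → nats σ 6 ≡ κ × nats σ 7 ≡ w × Bracket c b κ w

      refining-step : ∀ f σ → Refining (suc f) σ →
        0 ℕ.< (nats σ 7 ℕ.∸ 1) ℕ.* (nats σ 7 ℕ.* nats σ 1 ℕ.∸ nats σ 6) →
        Runs (nat[ lit 7 ]≔ #u ⊘ lit 2 ⨾
              nat[ lit 5 ]≔ #p ⊕ #u ⨾
              probe ⨾
              accept) σ 100 (Refining f)
      refining-step f σ (_ , zero , _ , u≡ , _) 0<z =
        -- A window of length 1 makes the first factor of the test vanish.
        contradiction (subst (λ u → 0 ℕ.< (u ℕ.∸ 1) ℕ.* (nats σ 7 ℕ.* nats σ 1 ℕ.∸ nats σ 6)) u≡ 0<z) λ ()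
      refining-step f σ (ctx , suc q , κ , u≡ , p≡ , 1≤κ , reached , missed , fine) _ = within 100
        (_⨟_ {Q = λ σ′ → σ′ ≡ σ₁} (setsNat (cong (λ z → setNat 7 z σ) half)) λ { refl →
         _⨟_ {Q = λ σ′ → σ′ ≡ σ₂} (setsNat (cong (λ z → setNat 5 (z ℕ.+ 2 ℕ.^ q) σ₁) p≡)) λ { refl →
         _⨟_ {Q = λ σ′ → Runs accept σ′ 10 (Refining f)}
           (probe-runs ctx
             (λ ctx′ r → accept-yes refl
               (ctx′ , q , κ ℕ.+ 2 ℕ.^ q , refl , refl , ℕ.≤-trans 1≤κ (ℕ.m≤m+n κ _) , r ,
                (λ r′ → missed (subst (Reaches c b) (lemma κ (2 ℕ.^ q)) r′)) ,
                ℕ.≤-trans fine′ (ℕ.*-monoʳ-≤ (2 ℕ.^ f) (ℕ.m≤m+n κ _))))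
             (λ ctx′ r → accept-no refl
               (ctx′ , q , κ , refl , p≡ , 1≤κ , reached , r , fine′)))
           λ r → r }})
        where
        σ₁ = setNat 7 (2 ℕ.^ q) σ
        σ₂ = setNat 5 (κ ℕ.+ 2 ℕ.^ q) σ₁
        half : quotient (nats σ 7) 2 ≡ 2 ℕ.^ q
        half = trans (cong (ℕ._/ 2) (trans u≡ (ℕ.*-comm 2 (2 ℕ.^ q)))) (ℕ.m*n/n≡m (2 ℕ.^ q) 2)
        lemma : ∀ κ p → κ ℕ.+ p ℕ.+ p ≡ κ ℕ.+ 2 ℕ.* p
        lemma = ℕ-Solver.solve-∀
        fine′ : 2 ℕ.^ q ℕ.* m ℕ.≤ 2 ℕ.^ f ℕ.* κ
        fine′ = ℕ.*-cancelˡ-≤ 2 (subst₂ ℕ._≤_ (ℕ.*-assoc 2 (2 ℕ.^ q) m) (ℕ.*-assoc 2 (2 ℕ.^ f) κ) fine)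

      refining-stop : ∀ σ → Refining 0 σ →
        ¬ 0 ℕ.< (nats σ 7 ℕ.∸ 1) ℕ.* (nats σ 7 ℕ.* nats σ 1 ℕ.∸ nats σ 6)
      refining-stop σ ((_ , m≡ , _) , q , κ , u≡ , p≡ , _ , _ , _ , fine) 0<z =
        ℕ.<-irrefl (sym (trans (cong ((nats σ 7 ℕ.∸ 1) ℕ.*_) zero-factor) (ℕ.*-zeroʳ (nats σ 7 ℕ.∸ 1)))) 0<z
        where
        zero-factor : nats σ 7 ℕ.* nats σ 1 ℕ.∸ nats σ 6 ≡ 0
        zero-factor = trans (cong₂ ℕ._∸_ (cong₂ ℕ._*_ u≡ m≡) p≡)
          (ℕ.m≤n⇒m∸n≡0 (subst (2 ℕ.^ q ℕ.* m ℕ.≤_) (ℕ.*-identityˡ κ) fine))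

      refined : ∀ σ → (¬ 0 ℕ.< (nats σ 7 ℕ.∸ 1) ℕ.* (nats σ 7 ℕ.* nats σ 1 ℕ.∸ nats σ 6)) ×
                ∃ (λ f → Refining f σ) → Refined σ
      refined σ (z≯0 , _ , ctx@(_ , m≡ , _) , q , κ , u≡ , p≡ , 1≤κ , reached , missed , _) =
        ctx , κ , 2 ℕ.^ q , p≡ , u≡ , 1≤κ , ℕ.m^n>0 2 q , reached , missed , fine q u≡
        where
        -- The test fails because one of its two factors is zero; these are the two alternatives in
        -- `Bracket`.
        fine : ∀ q → nats σ 7 ≡ 2 ℕ.^ q → 2 ℕ.^ q ≡ 1 ⊎ 2 ℕ.^ q ℕ.* m ℕ.≤ κ
        fine zero    _ = inj₁ refl
        fine (suc q) u≡ with 2 ℕ.^ suc q ℕ.* m ℕ.≤? κ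
        ... | yes um≤κ = inj₂ um≤κ
        ... | no um≰κ = contradiction
          (subst₂ (λ u d → 0 ℕ.< (u ℕ.∸ 1) ℕ.* d) (sym u≡)
            (sym (cong₂ ℕ._∸_ (cong₂ ℕ._*_ u≡ m≡) p≡))
            (ℕ.*-mono-< (ℕ.m<n⇒0<n∸m (ℕ.*-monoʳ-≤ 2 (ℕ.m^n>0 2 q))) (ℕ.m<n⇒0<n∸m (ℕ.≰⇒> um≰κ))))
          z≯0

      refine-runs : ∀ {σ} → Descended σ → Runs refine σ (100 ℕ.+ e ℕ.* 115) Refined
      refine-runs {σ} (ctx , q , p≡ , reached , missed) =
        within′ (slack 4 (e ℕ.* 115) 15)
        (_⨟_ {Q = Refining e}
          (setsNat (ctx , q , 2 ℕ.^ q , p≡ , p≡ , ℕ.m^n>0 2 q , reached , missed ,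
            ℕ.≤-reflexive (trans (ℕ.*-comm (2 ℕ.^ q) m) (cong (ℕ._* 2 ℕ.^ q) m≡2^e))))
          λ {σ′} inv → concludes (loops Refining refining-step refining-stop e σ′ inv) refined)

      Moved : State → Set
      Moved σ = nats σ 0 ≡ n × nats σ 1 ≡ m × ∃ λ κ → ∃ λ w → Bracket c b κ w ×
        ∃ λ c′ → c′ ≡ n ℕ.⊓ (c ℕ.+ (κ ℕ.+ w ℕ.∸ 1) ℕ.* b) ×
        nats σ 2 ≡ c′ × reals σ 0 ≡ T₀ + fromℕ (c′ ℕ.∸ c) * v c

      move-runs : ∀ {σ} → Refined σ → Runs move σ 100 Moved
      move-runs {σ} (ctx@(n≡ , m≡ , c≡ , b≡ , _) , κ , w , p≡ , u≡ , bracket) = within 100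
        (_⨟_ {Q = λ σ′ → σ′ ≡ setNat 5 x σ} (setsNat (cong (λ z → setNat 5 z σ) x≡)) λ { refl →
         _⨟_ {Q = λ σ′ → Ctx σ′ × nats σ′ 5 ≡ n ℕ.⊓ x}
           (branches {B = 4}
             (λ n<x → setsNat (ctx , trans n≡ (sym (ℕ.m≤n⇒m⊓n≡m (ℕ.<⇒≤ (subst (ℕ._< x) n≡ n<x))))))
             (λ n≮x → within 4 (skips
               (ctx , sym (ℕ.m≥n⇒m⊓n≡n (ℕ.≮⇒≥ λ n<x → n≮x (subst (ℕ._< x) (sym n≡) n<x)))))))
           λ { {σ′} ((n≡ , m≡ , c≡ , b≡ , T≡ , v≡) , c′≡) →
         _⨟_ {Q = λ σ″ → σ″ ≡ setReal 0 (reals σ′ 0 + fromℕ (nats σ′ 5 ℕ.∸ nats σ′ 2) * reals σ′ 1) σ′}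
           (setsReal refl)
           λ { refl → setsNat (n≡ , m≡ , κ , w , bracket , n ℕ.⊓ x , refl , c′≡ ,
             trans (cong₂ (λ t z → t + fromℕ (nats σ′ 5 ℕ.∸ nats σ′ 2) * z) T≡ v≡)
               (cong₂ (λ k z → T₀ + fromℕ (k ℕ.∸ z) * v c) c′≡ c≡)) } } })
        where
        x = c ℕ.+ (κ ℕ.+ w ℕ.∸ 1) ℕ.* b
        x≡ : nats σ 2 ℕ.+ (nats σ 6 ℕ.+ nats σ 7 ℕ.∸ 1) ℕ.* nats σ 3 ≡ x
        x≡ = cong₂ ℕ._+_ c≡ (cong₂ (λ k b → (k ℕ.∸ 1) ℕ.* b) (cong₂ ℕ._+_ p≡ u≡) b≡)

-- The main loop as a chain of jumps.

module Loop (𝓡 : RealNumbers) {n : ℕ} (a : Vector (RealNumbers.ℝ 𝓡) n)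
  (v : ℕ → RealNumbers.ℝ 𝓡)
  (entry : ∀ x → x ℕ.< n → ∃ λ i → n ℕ.∸ suc x ≡ toℕ i × a i ≡ v x)
  (nonneg : ∀ x → RealNumbers._≤_ 𝓡 (RealNumbers.0# 𝓡) (v x))
  (antitone : ∀ {i j} → i ℕ.≤ j → RealNumbers._≤_ 𝓡 (v j) (v i))
  (μ e L : ℕ) (m≡2^e : suc μ ≡ 2 ℕ.^ e) (n<tower : n ℕ.< 2 ℕ.^ (2 ℕ.^ L)) where
  open RealNumbers 𝓡
  open OrderedFieldProperties orderedField
  open Machine 𝓡
  open Execution 𝓡 a
  open Search 𝓡 a v entry nonneg μ
  open Jumps orderedField

  -- Thus one block already raises the rank by the factor 1 + 1/m.
  c≤m*[1+c/m] : ∀ c → c ℕ.≤ m ℕ.* suc (c ℕ./ m)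
  c≤m*[1+c/m] c = begin
    c                                 ≡⟨ ℕ.m≡m%n+[m/n]*n c m ⟩
    c ℕ.% m ℕ.+ c ℕ./ m ℕ.* m         ≤⟨ ℕ.+-monoˡ-≤ _ (ℕ.<⇒≤ (ℕ.m%n<n c m)) ⟩
    m ℕ.+ c ℕ./ m ℕ.* m               ≡⟨ ℕ.*-comm (suc (c ℕ./ m)) m ⟩
    m ℕ.* suc (c ℕ./ m)               ∎
    where open ℕ.≤-Reasoning

  module _ {c l κ w : ℕ} (n≡c+l : n ≡ c ℕ.+ l) where

    private
      b = suc (c ℕ./ m)
      c′ = n ℕ.⊓ (c ℕ.+ (κ ℕ.+ w ℕ.∸ 1) ℕ.* b)

    -- The known elements are those up to the rank of the successful trial κ, by monotonicity; the
    -- `u` unknown ones lie between it and the end of the jump. The rest of the chain is left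
    -- abstract, as it arises only when the loop goes on.
    bracket⇒jump : Bracket c b κ w →
      ∃ λ y → ∃ λ u → ∃ λ l′ → c′ ≡ c ℕ.+ (suc y ℕ.+ u) × l ≡ suc y ℕ.+ u ℕ.+ l′ ×
      (∀ {K S} → Jumps m v (c ℕ.+ (suc y ℕ.+ u)) l′ K S →
                 Jumps m v c (suc y ℕ.+ u ℕ.+ l′) (suc K) (fromℕ (suc y ℕ.+ u) * v c + S))
    bracket⇒jump (ℕ.s≤s {n = κ′} _ , 1≤w , (pos<n , near) , missed , tight) =
      y , u , l′ , c′≡ , l≡ , jump y u
        (λ i i≤y → ≤-trans near (*-monoʳ-≤ (0≤fromℕ (suc m)) (antitone (ℕ.+-monoʳ-≤ c i≤y))))
        few
        -- If something remains, the jump was not cut off, so the failed trial looked inside the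
        -- list and must have failed because of the value.
        (λ 0<l′ → subst (λ z → fromℕ (suc m) * v z < fromℕ m * v c)
          (trans (sym (c′≡X 0<l′)) c′≡)
          (≰⇒> λ near′ → missed (subst (ℕ._< n) (c′≡X 0<l′) (c′<n 0<l′) , near′)))
        λ 0<l′ → subst (λ z → suc m ℕ.* c ℕ.≤ m ℕ.* z) (trans (sym (c′≡X 0<l′)) c′≡) grow
      where
      open ℕ.≤-Reasoning
      y = κ′ ℕ.* b
      x = c ℕ.+ suc y
      X = c ℕ.+ (κ′ ℕ.+ w) ℕ.* b
      X≡ : X ≡ c ℕ.+ (y ℕ.+ w ℕ.* b)
      X≡ = cong (c ℕ.+_) (ℕ.*-distribʳ-+ b κ′ w)
      x≤c′ : x ℕ.≤ c′
      x≤c′ = ℕ.⊓-glb (subst (ℕ._≤ n) (sym (ℕ.+-suc c y)) pos<n)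
        (subst (x ℕ.≤_) (sym X≡) (ℕ.+-monoʳ-≤ c
          (subst (ℕ._≤ y ℕ.+ w ℕ.* b) (ℕ.+-comm y 1)
            (ℕ.+-monoʳ-≤ y (ℕ.*-mono-≤ 1≤w (ℕ.s≤s (ℕ.z≤n {c ℕ./ m})))))))
      u = c′ ℕ.∸ x
      l′ = n ℕ.∸ c′
      c′≡ : c′ ≡ c ℕ.+ (suc y ℕ.+ u)
      c′≡ = trans (sym (ℕ.m+[n∸m]≡n x≤c′)) (ℕ.+-assoc c (suc y) u)
      n≡c′+l′ : n ≡ c′ ℕ.+ l′
      n≡c′+l′ = sym (ℕ.m+[n∸m]≡n (ℕ.m⊓n≤m n X))
      l≡ : l ≡ suc y ℕ.+ u ℕ.+ l′
      l≡ = ℕ.+-cancelˡ-≡ c l _ (trans (sym n≡c+l) (trans n≡c′+l′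
        (trans (cong (ℕ._+ l′) c′≡) (ℕ.+-assoc c (suc y ℕ.+ u) l′))))
      u<wb : u ℕ.< w ℕ.* b
      u<wb = ℕ.+-cancelˡ-≤ (c ℕ.+ y) _ _ (begin
        c ℕ.+ y ℕ.+ suc u        ≡⟨ lemma c y u ⟩
        c ℕ.+ (suc y ℕ.+ u)      ≡⟨ c′≡ ⟨
        c′                       ≤⟨ ℕ.m⊓n≤n n X ⟩
        X                        ≡⟨ X≡ ⟩
        c ℕ.+ (y ℕ.+ w ℕ.* b)    ≡⟨ ℕ.+-assoc c y _ ⟨
        c ℕ.+ y ℕ.+ w ℕ.* b      ∎)
        where
        lemma : ∀ c y u → c ℕ.+ y ℕ.+ suc u ≡ c ℕ.+ (suc y ℕ.+ u)
        lemma = ℕ-Solver.solve-∀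
      -- For w = 1, the strictness of `u<wb` leaves u ≤ c/m. Otherwise m u is at most κ b = b + y,
      -- and b ≤ 1 + c.
      few : m ℕ.* u ℕ.≤ c ℕ.+ suc y
      few = few′ tight
        where
        few′ : w ≡ 1 ⊎ w ℕ.* m ℕ.≤ suc κ′ → m ℕ.* u ℕ.≤ c ℕ.+ suc y
        few′ (inj₁ w≡1) = begin
          m ℕ.* u              ≤⟨ ℕ.*-monoʳ-≤ m (ℕ.≤-pred (subst (u ℕ.<_) (trans (cong (ℕ._* b) w≡1) (ℕ.*-identityˡ b)) u<wb)) ⟩
          m ℕ.* (c ℕ./ m)      ≡⟨ ℕ.*-comm m (c ℕ./ m) ⟩
          c ℕ./ m ℕ.* m        ≤⟨ ℕ.m/n*n≤m c m ⟩
          c                    ≤⟨ ℕ.m≤m+n c (suc y) ⟩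
          c ℕ.+ suc y          ∎
        few′ (inj₂ wm≤κ) = begin
          m ℕ.* u              ≤⟨ ℕ.*-monoʳ-≤ m (ℕ.<⇒≤ u<wb) ⟩
          m ℕ.* (w ℕ.* b)      ≡⟨ trans (sym (ℕ.*-assoc m w b)) (cong (ℕ._* b) (ℕ.*-comm m w)) ⟩
          w ℕ.* m ℕ.* b        ≤⟨ ℕ.*-monoˡ-≤ b wm≤κ ⟩
          b ℕ.+ y              ≤⟨ ℕ.+-monoˡ-≤ y (ℕ.s≤s (ℕ.m/n≤m c m)) ⟩
          suc c ℕ.+ y          ≡⟨ ℕ.+-suc c y ⟨
          c ℕ.+ suc y          ∎
      c′<n : 0 ℕ.< l′ → c′ ℕ.< n
      c′<n 0<l′ = subst (suc c′ ℕ.≤_) (sym n≡c′+l′)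
        (subst (ℕ._≤ c′ ℕ.+ l′) (ℕ.+-comm c′ 1) (ℕ.+-monoʳ-≤ c′ 0<l′))
      c′≡X : 0 ℕ.< l′ → c′ ≡ X
      c′≡X 0<l′ with ℕ.⊓-sel n X
      ... | inj₂ eq = eq
      ... | inj₁ eq = contradiction (c′<n 0<l′) (ℕ.<-irrefl eq)
      grow : suc m ℕ.* c ℕ.≤ m ℕ.* X
      grow = begin
        c ℕ.+ m ℕ.* c                          ≤⟨ ℕ.+-monoˡ-≤ (m ℕ.* c) (c≤m*[1+c/m] c) ⟩
        m ℕ.* b ℕ.+ m ℕ.* c                    ≡⟨ trans (sym (ℕ.*-distribˡ-+ m b c)) (cong (m ℕ.*_) (ℕ.+-comm b c)) ⟩
        m ℕ.* (c ℕ.+ b)                        ≤⟨ ℕ.*-monoʳ-≤ m (ℕ.+-monoʳ-≤ c (ℕ.m≤n*m b (κ′ ℕ.+ w)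
                                                    {{ℕ.>-nonZero (ℕ.≤-trans 1≤w (ℕ.m≤n+m w κ′))}})) ⟩
        m ℕ.* X                                ∎

  -- 18 pays for the assignment and the query that open `step`; the other summands belong to its
  -- four phases.
  stepBound : ℕ
  stepBound = 18 ℕ.+ (100 ℕ.+ L ℕ.* 104 ℕ.+ (100 ℕ.+ L ℕ.* 104 ℕ.+ (100 ℕ.+ e ℕ.* 115 ℕ.+ 100)))

  step-runs : ∀ {c σ} → nats σ 0 ≡ n → nats σ 1 ≡ m → nats σ 2 ≡ c → c ℕ.< n →
    Runs step σ stepBound (Moved {c} {c ℕ./ m} {reals σ 0} L n<tower e m≡2^e)
  step-runs {c} {σ} n≡ m≡ c≡ c<n with i , i≡ , a≡v ← entry c c<n =
    _⨟_ {Q = λ σ′ → σ′ ≡ setNat 3 (suc (c ℕ./ m)) σ}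
      (setsNat (cong (λ z → setNat 3 (suc z) σ) (cong₂ quotient c≡ m≡))) λ { refl →
    _⨟_ {Q = λ σ′ → Context c (suc (c ℕ./ m)) (reals σ 0) σ′}
      (queries i (trans (cong₂ (λ n c → n ℕ.∸ suc c) n≡ c≡) i≡) (n≡ , m≡ , c≡ , refl , refl , a≡v))
      λ ctx → ascend-runs L n<tower ctx ⨟ λ {σ′} asc → descend-runs L n<tower {σ′} c<n asc ⨟
        λ {σ″} desc → refine-runs L n<tower e m≡2^e {σ″} desc ⨟
        λ {σ‴} ref → move-runs L n<tower e m≡2^e {σ‴} ref }

  Advanced : ℕ → ℕ → ℝ → State → Set
  Advanced c l T₀ σ = ∃ λ y → ∃ λ u → ∃ λ l′ → l ≡ suc y ℕ.+ u ℕ.+ l′ ×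
    (∀ {K S} → Jumps m v (c ℕ.+ (suc y ℕ.+ u)) l′ K S →
               Jumps m v c (suc y ℕ.+ u ℕ.+ l′) (suc K) (fromℕ (suc y ℕ.+ u) * v c + S)) ×
    nats σ 0 ≡ n × nats σ 1 ≡ m × nats σ 2 ≡ c ℕ.+ (suc y ℕ.+ u) ×
    reals σ 0 ≡ T₀ + fromℕ (suc y ℕ.+ u) * v c

  moved⇒advanced : ∀ {c l T₀} → n ≡ c ℕ.+ l → ∀ σ →
    Moved {c} {c ℕ./ m} {T₀} L n<tower e m≡2^e σ → Advanced c l T₀ σ
  moved⇒advanced {c} {l} {T₀} n≡c+l σ (n≡ , m≡ , κ , w , bracket , c′ , c′≡ , c≡ , T≡) =
    advance (bracket⇒jump n≡c+l bracket)
    where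
    advance : _ → Advanced c l T₀ σ
    advance (y , u , l′ , c″≡ , l≡ , jump′) = y , u , l′ , l≡ , jump′ , n≡ , m≡ ,
      trans c≡ (trans c′≡ c″≡) ,
      trans T≡ (cong (λ z → T₀ + fromℕ z * v c)
        (trans (cong (ℕ._∸ c) (trans c′≡ c″≡)) (ℕ.m+n∸m≡n c (suc y ℕ.+ u))))

  advance-runs : ∀ {c l σ} → nats σ 0 ≡ n → nats σ 1 ≡ m → nats σ 2 ≡ c → n ≡ c ℕ.+ l → c ℕ.< n →
    Runs step σ stepBound (Advanced c l (reals σ 0))
  advance-runs n≡ m≡ c≡ n≡c+l c<n = concludes (step-runs n≡ m≡ c≡ c<n) (moved⇒advanced n≡c+l)

  -- The time bound depends on the number K of jumps, which is known only after the run.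
  LoopRuns : ℕ → ℕ → ℕ → State → Set
  LoopRuns B c l σ = ∃ λ K → ∃ λ S → Jumps m v c l K S ×
    Runs (while nat≺ #c #n loop step end) σ (K ℕ.* (5 ℕ.+ B) ℕ.+ 5)
      (λ σ′ → reals σ′ 0 ≡ reals σ 0 + S)

  loop-exits : ∀ {B c σ} → nats σ 0 ≡ n → nats σ 2 ≡ c → n ≡ c ℕ.+ 0 → LoopRuns B c 0 σ
  loop-exits {c = c} n≡ c≡ n≡c+0 = 0 , 0# , done ,
    run (⇓exit (ℕ.<-irrefl (trans c≡ (trans (sym (trans n≡c+0 (ℕ.+-identityʳ c))) (sym n≡)))))
      ℕ.≤-refl (sym (+-identityʳ _))

  loop-iterates : ∀ {B c l f σ} → l ℕ.≤ suc f → nats σ 2 ℕ.< nats σ 0 → n ≡ c ℕ.+ l →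
    Runs step σ B (Advanced c l (reals σ 0)) →
    (∀ c′ l′ σ′ → l′ ℕ.≤ f → n ≡ c′ ℕ.+ l′ → nats σ′ 0 ≡ n → nats σ′ 1 ≡ m → nats σ′ 2 ≡ c′ →
      LoopRuns B c′ l′ σ′) →
    LoopRuns B c l σ
  loop-iterates {B} {c} {σ = σ} (ℕ.s≤s l≤f) c<n n≡c+l
    (run {final = σ′} d t≤ (y , u , l′ , refl , jump′ , n≡ , m≡ , c≡ , T≡)) continue =
    iterate (continue (c ℕ.+ (suc y ℕ.+ u)) l′ σ′ (ℕ.≤-trans (ℕ.m≤n+m l′ (y ℕ.+ u)) l≤f)
      (trans n≡c+l (sym (ℕ.+-assoc c (suc y ℕ.+ u) l′))) n≡ m≡ c≡)
    where
    lemma : ∀ c B x → c ℕ.+ (B ℕ.+ (x ℕ.+ c)) ≡ c ℕ.+ B ℕ.+ x ℕ.+ c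
    lemma = ℕ-Solver.solve-∀
    iterate : LoopRuns B (c ℕ.+ (suc y ℕ.+ u)) l′ σ′ → LoopRuns B c (suc y ℕ.+ u ℕ.+ l′) σ
    iterate (K , S , js , run d′ s≤ S≡) =
      suc K , fromℕ (suc y ℕ.+ u) * v c + S , jump′ js ,
      run (⇓iterate c<n d d′)
        (ℕ.≤-trans (ℕ.+-monoʳ-≤ 5 (ℕ.+-mono-≤ t≤ s≤)) (ℕ.≤-reflexive (lemma 5 B (K ℕ.* (5 ℕ.+ B)))))
        (trans S≡ (trans (cong (_+ S) T≡) (+-assoc (reals σ 0) (fromℕ (suc y ℕ.+ u) * v c) S)))

  -- The bound `f` makes the recursion structural: a jump shortens `l` by a positive amount that the
  -- run determines.
  loop-runs : ∀ f c l σ → l ℕ.≤ f → n ≡ c ℕ.+ l → nats σ 0 ≡ n → nats σ 1 ≡ m → nats σ 2 ≡ c →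
    LoopRuns stepBound c l σ
  loop-runs f       c zero    σ _   n≡c+l n≡ _  c≡ = loop-exits n≡ c≡ n≡c+l
  loop-runs (suc f) c (suc l) σ l≤f n≡c+l n≡ m≡ c≡ =
    loop-iterates l≤f (subst₂ ℕ._<_ (sym c≡) (sym n≡) c<n) n≡c+l
      (advance-runs n≡ m≡ c≡ n≡c+l c<n) (loop-runs f)
    where
    c<n : c ℕ.< n
    c<n = subst (c ℕ.<_) (sym n≡c+l) (ℕ.m<m+n c (ℕ.s≤s ℕ.z≤n))

-- The choice of the scale.

module ScaleChoice (𝓡 : RealNumbers) {n : ℕ} (a : Vector (RealNumbers.ℝ 𝓡) n)
  {ε : RealNumbers.ℝ 𝓡} where
  open RealNumbers 𝓡
  open Machine 𝓡
  open Execution 𝓡 a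

  Scaled : ℕ → State → Set
  Scaled i σ = nats σ 0 ≡ n × nats σ 1 ≡ 2 ℕ.^ i × nats σ 2 ≡ 0 × reals σ 0 ≡ ε

  Coarse : ℕ → Set
  Coarse i = fromℕ (2 ℕ.^ i) * ε < fromℕ 2 + ε

  -- The double negation is the minimality of `e` for `Fine`, itself a negation; this suffices to
  -- refute an early exit.
  chooseScale-runs : ∀ e → ¬ Coarse e → (∀ i → i ℕ.< e → ¬ ¬ Coarse i) →
    Runs chooseScale (initial n ε) (3 ℕ.+ (e ℕ.* 18 ℕ.+ 12)) (Scaled e)
  chooseScale-runs e fine coarse =
    _⨟_ {Q = Inv e} (setsNat (0 , ℕ.+-identityʳ e , refl , refl , refl , refl)) λ {σ} inv →
      concludes (loops Inv body stop e σ inv) scaled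
    where
    Inv : ℕ → State → Set
    Inv f σ = ∃ λ i → f ℕ.+ i ≡ e × Scaled i σ

    test⇒coarse : ∀ i σ → Scaled i σ →
      (fromℕ (nats σ 1) * reals σ 0 < fromℕ 2 + reals σ 0) ≡ Coarse i
    test⇒coarse i σ (_ , m≡ , _ , ε≡) = cong₂ (λ k x → fromℕ k * x < fromℕ 2 + x) m≡ ε≡

    body : ∀ f σ → Inv (suc f) σ → fromℕ (nats σ 1) * reals σ 0 < fromℕ 2 + reals σ 0 →
           Runs (nat[ lit 1 ]≔ lit 2 ⊗ #m) σ 6 (Inv f)
    body f σ (i , f+i≡e , n≡ , m≡ , c≡ , ε≡) _ =
      setsNat (suc i , trans (ℕ.+-suc f i) f+i≡e , n≡ , cong (2 ℕ.*_) m≡ , c≡ , ε≡)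

    stop : ∀ σ → Inv 0 σ → ¬ fromℕ (nats σ 1) * reals σ 0 < fromℕ 2 + reals σ 0
    stop σ (i , refl , scaled) h = fine (subst (λ A → A) (test⇒coarse i σ scaled) h)

    scaled : ∀ σ → (¬ fromℕ (nats σ 1) * reals σ 0 < fromℕ 2 + reals σ 0) × ∃ (λ f → Inv f σ) →
             Scaled e σ
    scaled σ (¬h , zero , i , refl , s) = s
    scaled σ (¬h , suc f , i , refl , s) =
      contradiction (λ h → ¬h (subst (λ A → A) (sym (test⇒coarse i σ s)) h))
                    (coarse i (ℕ.m<n+m i (ℕ.s≤s ℕ.z≤n)))

-- The list in decreasing order.

module Ranks (𝓡 : RealNumbers) where
  open RealNumbers 𝓡
  open OrderedFieldProperties orderedField
  open Jumps orderedField

  -- Padding with zeros keeps a decreasing list of nonnegative numbers decreasing on all of `ℕ`.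
  at : ∀ {n} → Vector ℝ n → ℕ → ℝ
  at {zero}  d x       = 0#
  at {suc n} d zero    = d Fin.zero
  at {suc n} d (suc x) = at (d ∘ Fin.suc) x

  at-toℕ : ∀ {n} (d : Vector ℝ n) i → at d (toℕ i) ≡ d i
  at-toℕ d Fin.zero    = refl
  at-toℕ d (Fin.suc i) = at-toℕ (d ∘ Fin.suc) i

  at-cases : ∀ {n} (d : Vector ℝ n) x → at d x ≡ 0# ⊎ ∃ λ i → toℕ i ≡ x × at d x ≡ d i
  at-cases {zero}  d x       = inj₁ refl
  at-cases {suc n} d zero    = inj₂ (Fin.zero , refl , refl)
  at-cases {suc n} d (suc x) with at-cases (d ∘ Fin.suc) x
  ... | inj₁ ≡0             = inj₁ ≡0
  ... | inj₂ (i , i≡x , ≡d) = inj₂ (Fin.suc i , cong suc i≡x , ≡d)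

  sumFrom-at : ∀ {n} (d : Vector ℝ n) → sumFrom (at d) 0 n ≡ sum d
  sumFrom-at {zero}  d = refl
  sumFrom-at {suc n} d = cong (d Fin.zero +_) (trans (shift 0 n) (sumFrom-at (d ∘ Fin.suc)))
    where
    shift : ∀ c l → sumFrom (at d) (suc c) l ≡ sumFrom (at (d ∘ Fin.suc)) c l
    shift c zero    = refl
    shift c (suc l) = cong (at (d ∘ Fin.suc) c +_) (shift (suc c) l)

  -- The entries in decreasing order, followed by zeros.
  ranked : ∀ {n} → Vector ℝ n → ℕ → ℝ
  ranked a = at (a ∘ opposite)

  module _ {n : ℕ} (a : Vector ℝ n) where

    sumFrom-ranked : sumFrom (ranked a) 0 n ≡ sum a
    sumFrom-ranked = trans (sumFrom-at (a ∘ opposite))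
      (sym (Sum.sum-permute (CommutativeRing.+-commutativeMonoid commutativeRing) a reverse))

    ranked-entry : ∀ x → x ℕ.< n → ∃ λ i → n ℕ.∸ suc x ≡ toℕ i × a i ≡ ranked a x
    ranked-entry x x<n = opposite i
      , sym (trans (Fin.opposite-prop i) (cong (λ x → n ℕ.∸ suc x) toℕi≡x))
      , trans (sym (at-toℕ (a ∘ opposite) i)) (cong (ranked a) toℕi≡x)
      where
      i = fromℕ< x<n
      toℕi≡x = Fin.toℕ-fromℕ< x<n

    module _ (nonneg : ∀ i → 0# ≤ a i) where

      ranked-nonneg : ∀ x → 0# ≤ ranked a x
      ranked-nonneg x with at-cases (a ∘ opposite) x
      ... | inj₁ ≡0           = ≤-reflexive (sym ≡0)
      ... | inj₂ (i , _ , ≡a) = subst (0# ≤_) (sym ≡a) (nonneg (opposite i))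

      ranked-antitone : (∀ {i j} → i Fin.≤ j → a i ≤ a j) →
                        ∀ {x y} → x ℕ.≤ y → ranked a y ≤ ranked a x
      ranked-antitone sorted {x} {y} x≤y with at-cases (a ∘ opposite) y
      ... | inj₁ ≡0 = subst (_≤ ranked a x) (sym ≡0) (ranked-nonneg x)
      ... | inj₂ (j , refl , ≡a)
        with i , i≡ , aᵢ≡ ← ranked-entry x (ℕ.≤-<-trans x≤y (Fin.toℕ<n j)) =
        subst₂ _≤_ (sym ≡a) aᵢ≡ (sorted (subst₂ ℕ._≤_ (sym (Fin.opposite-prop j)) i≡
          (ℕ.∸-monoʳ-≤ n (ℕ.s≤s x≤y))))

-- Correctness and running time.

module Analysis (𝓡 : RealNumbers) (𝓛 : BinaryLogarithm 𝓡) where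
  open RealNumbers 𝓡
  open BinaryLogarithm 𝓛
  open Machine 𝓡
  open SumApproximation 𝓡 𝓛
  open OrderedFieldProperties orderedField
  open Bounds 𝓡 𝓛
  open Ranks 𝓡
  open Jumps orderedField

  module _ (n : ℕ) (1≤n : 1 ≤ℕ n) (ε : ℝ) (0<ε : 0# < ε)
    (a : Vector ℝ n) (nonneg : Nonnegative a) (sorted : Sorted a)
    (e : ℕ) (fine : Fine 0<ε e) (coarse : ∀ i → i ℕ.< e → ¬ Fine 0<ε i)
    (L : ℕ) (n<tower : n ℕ.< 2 ℕ.^ (2 ℕ.^ L))
    (below : ∀ i → i ℕ.< L → ¬ n ℕ.< 2 ℕ.^ (2 ℕ.^ i))
    (μ : ℕ) (m≡2^e : suc μ ≡ 2 ℕ.^ e) where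
    open Execution 𝓡 a
    open Loop 𝓡 a (ranked a) (ranked-entry a) (ranked-nonneg a nonneg)
      (ranked-antitone a nonneg sorted) μ e L m≡2^e n<tower
    open ScaleChoice 𝓡 a

    v : ℕ → ℝ
    v = ranked a

    v-nonneg : ∀ x → 0# ≤ v x
    v-nonneg = ranked-nonneg a nonneg

    v-antitone : ∀ {i j} → i ℕ.≤ j → v j ≤ v i
    v-antitone = ranked-antitone a nonneg sorted

    positiveElement : ∀ {x} → 0# < v x → PositiveElement a (v x)
    positiveElement {x} 0<vx with at-cases (a ∘ opposite) x
    ... | inj₁ ≡0           = contradiction 0<vx (<-irrefl (sym ≡0))
    ... | inj₂ (i , _ , ≡a) = record { positive = 0<vx ; element = opposite i , sym ≡a }

    module _ {K S} (js : Jumps (suc μ) v 0 n K S) where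

      jumps≤log-n : fromℕ (K ℕ.∸ 2) ≤ fromℕ (suc μ) * log₂ (fromℕ n)
      jumps≤log-n = exponent≤log₂ (suc μ) (K ℕ.∸ 2) (0<fromℕ 1≤n)
        (subst (fromℕ (suc (suc μ) ℕ.^ (K ℕ.∸ 2)) ≤_) (fromℕ-* (suc μ ℕ.^ (K ℕ.∸ 2)) n)
          (fromℕ-mono-≤ (#jumps≤rank v-antitone v-nonneg 1≤n js)))

      -- The values in `jumps-value` are positive entries, so their ratio is at most xmax/xmin. With
      -- fewer than two jumps the exponent is 0.
      jumps≤log-spread : ∀ {r} → Spread a r →
        0# ≤ log₂ r × fromℕ (K ℕ.∸ 2) ≤ fromℕ (suc μ) * log₂ r
      jumps≤log-spread (ratio {xmax} {xmin} (pmax , above) (pmin , beneath)) =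
        subst (_≤ log₂ (xmax / xmin)) log₂-1 (log₂-mono-≤ (0<fromℕ {1} (ℕ.s≤s ℕ.z≤n)) 1≤r) ,
        exponent≤log₂ (suc μ) (K ℕ.∸ 2) 0<r (*-cancelˡ-≤ 0<xmin (begin
          xmin * fromℕ (suc (suc μ) ℕ.^ k)             ≡⟨ *-comm xmin _ ⟩
          fromℕ (suc (suc μ) ℕ.^ k) * xmin             ≤⟨ powers K js ⟩
          fromℕ (suc μ ℕ.^ k) * xmax                   ≡⟨ cong (fromℕ (suc μ ℕ.^ k) *_) (x*[y/x]≡y xmax 0<xmin) ⟨
          fromℕ (suc μ ℕ.^ k) * (xmin * (xmax / xmin)) ≡⟨ swap _ _ _ ⟩
          xmin * (fromℕ (suc μ ℕ.^ k) * (xmax / xmin)) ∎))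
        where
        open ≤-Reasoning
        open Solver using (solve; _:=_; _:*_)
        k = K ℕ.∸ 2
        0<xmin = PositiveElement.positive pmin
        0<r : 0# < xmax / xmin
        0<r = *-pos (PositiveElement.positive pmax) (⁻¹-pos 0<xmin)
        xmin≤xmax : xmin ≤ xmax
        xmin≤xmax = above xmin pmin
        1≤r : fromℕ 1 ≤ xmax / xmin
        1≤r = *-cancelˡ-≤ 0<xmin (subst₂ _≤_
          (sym (trans (cong (xmin *_) fromℕ-1) (*-identityʳ xmin)))
          (sym (x*[y/x]≡y xmax 0<xmin)) xmin≤xmax)
        swap : ∀ x y z → x * (y * z) ≡ y * (x * z)
        swap = solve 3 (λ x y z → x :* (y :* z) := y :* (x :* z)) refl
        powers : ∀ K → Jumps (suc μ) v 0 n K S →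
          fromℕ (suc (suc μ) ℕ.^ (K ℕ.∸ 2)) * xmin ≤ fromℕ (suc μ ℕ.^ (K ℕ.∸ 2)) * xmax
        powers zero          _  = *-monoʳ-≤ (0≤fromℕ 1) xmin≤xmax
        powers (suc zero)    _  = *-monoʳ-≤ (0≤fromℕ 1) xmin≤xmax
        powers (suc (suc k)) js with z , 0<vz , p ← jumps-value v-antitone v-nonneg js =
          ≤-trans (*-monoʳ-≤ (0≤fromℕ (suc (suc μ) ℕ.^ k)) (beneath (v z) (positiveElement {z} 0<vz)))
            (≤-trans p (*-monoʳ-≤ (0≤fromℕ (suc μ ℕ.^ k)) (above (v 0)
              (positiveElement {0} (<-≤-trans 0<vz (v-antitone ℕ.z≤n))))))
      jumps≤log-spread (noPositive none) = ≤-reflexive (sym log₂1≡0) , few K js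
        where
        log₂1≡0 : log₂ 1# ≡ 0#
        log₂1≡0 = trans (cong log₂ (sym fromℕ-1)) log₂-1
        few : ∀ K → Jumps (suc μ) v 0 n K S → fromℕ (K ℕ.∸ 2) ≤ fromℕ (suc μ) * log₂ 1#
        few zero          _  = ≤-reflexive (sym (trans (cong (fromℕ (suc μ) *_) log₂1≡0) (zeroʳ _)))
        few (suc zero)    _  = ≤-reflexive (sym (trans (cong (fromℕ (suc μ) *_) log₂1≡0) (zeroʳ _)))
        -- Two jumps would exhibit a positive entry.
        few (suc (suc k)) js with z , 0<vz , _ ← jumps-value v-antitone v-nonneg js =
          contradiction (positiveElement {z} 0<vz) (none (v z))

    approximates : ∀ {K S} → Jumps (suc μ) v 0 n K S → S IsApproximation[1+ ε ]Of sum a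
    approximates {K} {S} js =
      approximation 0<ε μ (sum a) S
        (subst (λ k → fromℕ 2 + ε ≤ fromℕ k * ε) (sym m≡2^e) (≮⇒≥ fine))
        (subst (0# ≤_) sum≡ (*-pres-0≤-sum 0 n))
        (subst (_≤ S) sum≡ (sum≤jumps v-antitone v-nonneg js))
        (subst (fromℕ (suc μ) * S ≤_)
          -- The boundary term of `jumps≤sum` vanishes at rank 0.
          (cong (_+ S) (trans (cong (fromℕ (suc (suc μ)) * sumFrom v 0 n +_) (zeroˡ (v 0)))
            (trans (+-identityʳ _) (cong (fromℕ (suc (suc μ)) *_) sum≡))))
          (jumps≤sum v-antitone v-nonneg js))
      where
      sum≡ : sumFrom v 0 n ≡ sum a
      sum≡ = sumFrom-ranked a
      *-pres-0≤-sum : ∀ c l → 0# ≤ sumFrom v c l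
      *-pres-0≤-sum c zero    = ≤-refl
      *-pres-0≤-sum c (suc l) = +-pres-0≤ (v-nonneg c) (*-pres-0≤-sum (suc c) l)

    time-sum : ∀ K → 3 ℕ.+ (e ℕ.* 18 ℕ.+ 12) ℕ.+ (4 ℕ.+ (K ℕ.* (5 ℕ.+ stepBound) ℕ.+ 5)) ℕ.≤
                     500 ℕ.* (suc (e ℕ.+ L) ℕ.* suc K)
    -- The added polynomial is the exact difference of the two sides.
    time-sum K = ℕ.≤-trans (ℕ.m≤m+n _ (476 ℕ.+ 482 ℕ.* e ℕ.+ 500 ℕ.* L ℕ.+ K ℕ.* (77 ℕ.+ 385 ℕ.* e ℕ.+ 292 ℕ.* L)))
      (ℕ.≤-reflexive (lemma e L K))
      where
      lemma : ∀ e L K →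
        3 ℕ.+ (e ℕ.* 18 ℕ.+ 12) ℕ.+ (4 ℕ.+ (K ℕ.* (5 ℕ.+ (18 ℕ.+ (100 ℕ.+ L ℕ.* 104 ℕ.+
          (100 ℕ.+ L ℕ.* 104 ℕ.+ (100 ℕ.+ e ℕ.* 115 ℕ.+ 100))))) ℕ.+ 5)) ℕ.+
          (476 ℕ.+ 482 ℕ.* e ℕ.+ 500 ℕ.* L ℕ.+ K ℕ.* (77 ℕ.+ 385 ℕ.* e ℕ.+ 292 ℕ.* L))
        ≡ 500 ℕ.* (suc (e ℕ.+ L) ℕ.* suc K)
      lemma = ℕ-Solver.solve-∀

    Outcome : Set
    Outcome = ∃ λ (t : ℕ) → ∃ λ (σ : State) →
      (a ⊢ approximateSum , initial n ε ⇓ t , σ) ×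
      (output σ IsApproximation[1+ ε ]Of sum a) ×
      (∀ r → Spread a r → fromℕ t ≤ fromℕ (500 ℕ.* 24) * timeBound n ε r)

    time-real : ∀ {t K S r} → Jumps (suc μ) v 0 n K S → Spread a r →
      t ℕ.≤ 500 ℕ.* (suc (e ℕ.+ L) ℕ.* suc K) →
      fromℕ t ≤ fromℕ (500 ℕ.* 24) * timeBound n ε r
    time-real {t} {K} {r = r} js spread t≤ = begin
      fromℕ t                                              ≤⟨ fromℕ-mono-≤ t≤ ⟩
      fromℕ (500 ℕ.* (suc (e ℕ.+ L) ℕ.* suc K))            ≡⟨ fromℕ-* 500 (suc (e ℕ.+ L) ℕ.* suc K) ⟩
      fromℕ 500 * fromℕ (suc (e ℕ.+ L) ℕ.* suc K)          ≤⟨ *-monoʳ-≤ (0≤fromℕ 500) bound ⟩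
      fromℕ 500 * (fromℕ 24 * timeBound n ε r)             ≡⟨ *-assoc (fromℕ 500) (fromℕ 24) _ ⟨
      fromℕ 500 * fromℕ 24 * timeBound n ε r               ≡⟨ cong (_* timeBound n ε r) (fromℕ-* 500 24) ⟨
      fromℕ (500 ℕ.* 24) * timeBound n ε r                 ∎
      where
      open ≤-Reasoning
      logs = jumps≤log-spread js spread
      bound : fromℕ (suc (e ℕ.+ L) ℕ.* suc K) ≤ fromℕ 24 * timeBound n ε r
      bound = time-bound 0<ε n e L K r 1≤n (proj₁ logs) coarse below
        (subst (λ k → fromℕ (K ℕ.∸ 2) ≤ fromℕ k * log₂ (fromℕ n)) m≡2^e (jumps≤log-n js))
        (subst (λ k → fromℕ (K ℕ.∸ 2) ≤ fromℕ k * log₂ r) m≡2^e (proj₂ logs))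

    outcome : Outcome
    outcome = start (chooseScale-runs e fine coarse)
      where
      finish : ∀ {σ t} → t ℕ.≤ 3 ℕ.+ (e ℕ.* 18 ℕ.+ 12) → a ⊢ chooseScale , initial n ε ⇓ t , σ →
               LoopRuns stepBound 0 n (setReal 0 0# σ) → Outcome
      finish {σ} t≤ d (K , S , js , run {t′} {σ′} d′ t′≤ S≡) =
        _ , σ′ , ⇓seq d (⇓seq ⇓real d′) ,
        subst (_IsApproximation[1+ ε ]Of sum a) (sym (trans S≡ (+-identityˡ S))) (approximates js) ,
        λ r spread → time-real js spread
          (ℕ.≤-trans (ℕ.+-mono-≤ t≤ (ℕ.+-monoʳ-≤ 4 t′≤)) (time-sum K))
      start : Runs chooseScale (initial n ε) (3 ℕ.+ (e ℕ.* 18 ℕ.+ 12)) (Scaled {ε} e) → Outcome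
      start (run {final = σ} d t≤ (n≡ , m≡ , c≡ , _)) =
        finish t≤ d (loop-runs n 0 n (setReal 0 0# σ) ℕ.≤-refl refl n≡ (trans m≡ (sym m≡2^e)) c≡)

theorem1 : (𝓡 : RealNumbers) (𝓛 : BinaryLogarithm 𝓡) →
    let open RealNumbers 𝓡
        open Machine 𝓡
        open SumApproximation 𝓡 𝓛
    in
    ∃ λ (P : Program) → ∃ λ (C : ℕ) →
      (n : ℕ) → 1 ≤ℕ n → (ε : ℝ) → 0# < ε →
      (a : Vector ℝ n) → Nonnegative a → Sorted a →
      ∃ λ (t : ℕ) → ∃ λ (σ : State) →
        (a ⊢ P , initial n ε ⇓ t , σ) ×
        (output σ IsApproximation[1+ ε ]Of sum a) ×
        (∀ r → Spread a r → fromℕ t ≤ fromℕ C * timeBound n ε r)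
theorem1 𝓡 𝓛 = approximateSum , 500 ℕ.* 24 , λ n 1≤n ε 0<ε a nonneg sorted →
  let e , fine , coarse = least (Fine 0<ε) (λ i → ¬? (_ <? _)) (∃-fine 0<ε)
      L , n<tower , below = least (λ i → n ℕ.< 2 ℕ.^ (2 ℕ.^ i)) (λ i → n ℕ.<? _)
        -- The search is bounded by `n` itself, as n < 2^n < 2^(2^n).
        (n , ℕ.<-trans (n<2^n n) (ℕ.^-monoʳ-< 2 (ℕ.s≤s (ℕ.s≤s ℕ.z≤n)) (n<2^n n)))
  in outcome n 1≤n ε 0<ε a nonneg sorted e fine coarse L n<tower below
       (ℕ.pred (2 ℕ.^ e)) (ℕ.suc-pred (2 ℕ.^ e) {{ℕ.m^n≢0 2 e}})
  where
  open RealNumbers 𝓡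
  open OrderedFieldProperties orderedField using (_<?_)
  open Bounds 𝓡 𝓛
  open Analysis 𝓡 𝓛
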